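{- Let $m$ and $k$ be positive integers, let $G$ be a graph and let $X\subseteq V(G)$. Then for every factor $M$ of $G$ with maximum degree $\Delta(M)\le m$, $G$ has an $m$-tree-connected factor $H$ containing $M$ such that for each $v\in X$, $$d_H(v)\le \begin{cases} \big\lceil \frac{m}{k}(d_G(v)-2m)\big \rceil+2m, &\text{if $G$ is $k$-edge-connected and $k\ge 2m$};\\ \big\lceil \frac{m}{k}(d_G(v)-m)\big\rceil+m, &\text{if $G$ is $k$-tree-connected and $k\ge m$};\\ \big\lceil \frac{m}{k}d_G(v)\big \rceil+m, &\text{if $G$ is $k$-edge-connected, $k\ge 2m$, and $X$ is independent};\\ \big\lceil \frac{m}{k}d_G(v)\big\rceil, &\text{if $G$ is $k$-tree-connected, $k\ge m$, and $X$ is independent}. \end{cases}$$ Furthermore, for an arbitrary given vertex $u\in X$, $H$ can be chosen so that in addition the upper bound at $u$ is reduced to $d_H(u)\le\lfloor \frac{m}{k}d_G(u)\rfloor$.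
   Context: Graphs are finite, loopless, and may have multiple edges. A factor of $G$ is a spanning subgraph. A graph is $m$-tree-connected (resp. $k$-tree-connected) if it contains $m$ (resp. $k$) pairwise edge-disjoint spanning trees. A set of vertices is independent if no edge joins two of its vertices. $d_G(v)$ denotes the degree of $v$ in $G$. -}

module Defs where

open import Data.Nat using (ℕ; zero; suc; _*_; _<_; _≤_; NonZero)
open import Data.Integer as ℤ using (ℤ; +_)
open import Data.Rational as ℚ using (ℚ; floor; ceiling)
open import Data.Fin using (Fin; _≟_)
open import Data.Fin.Subset using (Subset; _∈_; _∉_; _⊆_; ∣_∣; ⊤; _─_; ⁅_⁆; _∩_)
open import Data.Vec using (tabulate)
open import Data.Bool using (_∨_)
open import Data.Product using (_×_; Σ; proj₁; proj₂)
open import Data.Sum using (_⊎_)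
open import Relation.Nullary using (¬_; does)
open import Relation.Binary.PropositionalEquality using (_≡_; _≢_)

-- A finite loopless multigraph on vertex set Fin n with edge set Fin e;
-- edge i joins (proj₁ (ends i)) and (proj₂ (ends i)).
record Graph : Set where
  field
    n     : ℕ
    e     : ℕ
    ends  : Fin e → Fin n × Fin n
    loopless : ∀ i → proj₁ (ends i) ≢ proj₂ (ends i)
open Graph public

-- A factor (spanning subgraph) of G is given by its set of edges.
Factor : Graph → Set
Factor G = Subset (e G)

incident : (G : Graph) → Fin (n G) → Subset (e G)
incident G v = tabulate λ i → does (proj₁ (ends G i) ≟ v) ∨ does (proj₂ (ends G i) ≟ v)

deg : (G : Graph) → Factor G → Fin (n G) → ℕ
deg G S v = ∣ S ∩ incident G v ∣

data Reach (G : Graph) (S : Factor G) (x : Fin (n G)) : Fin (n G) → Set where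
  here : Reach G S x x
  step : ∀ {y} (i : Fin (e G)) → i ∈ S → Reach G S x y → (w : Fin (n G)) →
         ((proj₁ (ends G i) ≡ y × proj₂ (ends G i) ≡ w) ⊎ (proj₂ (ends G i) ≡ y × proj₁ (ends G i) ≡ w)) →
         Reach G S x w

Connected : (G : Graph) → Factor G → Set
Connected G S = ∀ x y → Reach G S x y

Acyclic : (G : Graph) → Factor G → Set
Acyclic G S = ∀ i → i ∈ S → ¬ Reach G (S ─ ⁅ i ⁆) (proj₁ (ends G i)) (proj₂ (ends G i))

SpanningTree : (G : Graph) → Factor G → Set
SpanningTree G T = Connected G T × Acyclic G T

TreeConnected : (G : Graph) → ℕ → Factor G → Set
TreeConnected G m S =
  Σ (Fin m → Factor G) λ Ts →
    (∀ j → Ts j ⊆ S) × (∀ j → SpanningTree G (Ts j)) ×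
    (∀ j j' i → i ∈ Ts j → i ∈ Ts j' → j ≡ j')

GTreeConnected : Graph → ℕ → Set
GTreeConnected G k = TreeConnected G k ⊤

EdgeConnected : Graph → ℕ → Set
EdgeConnected G k = ∀ (F : Subset (e G)) → ∣ F ∣ < k → Connected G (⊤ ─ F)

Independent : (G : Graph) → Subset (n G) → Set
Independent G X = ∀ i → ¬ (proj₁ (ends G i) ∈ X × proj₂ (ends G i) ∈ X)

MaxDegLe : (G : Graph) → Factor G → ℕ → Set
MaxDegLe G M m = ∀ v → deg G M v ≤ m

data Case : Set where
  case1 case2 case3 case4 : Case

CaseHyp : Case → (G : Graph) → Subset (n G) → ℕ → ℕ → Set
CaseHyp case1 G X m k = EdgeConnected G k × 2 * m ≤ k
CaseHyp case2 G X m k = GTreeConnected G k × m ≤ k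
CaseHyp case3 G X m k = EdgeConnected G k × 2 * m ≤ k × Independent G X
CaseHyp case4 G X m k = GTreeConnected G k × m ≤ k × Independent G X

CaseBound : Case → (m k d : ℕ) → .{{NonZero k}} → ℤ
CaseBound case1 m k d = ceiling ((+ m ℤ.* (+ d ℤ.- + (2 * m))) ℚ./ k) ℤ.+ + (2 * m)
CaseBound case2 m k d = ceiling ((+ m ℤ.* (+ d ℤ.- + m)) ℚ./ k) ℤ.+ + m
CaseBound case3 m k d = ceiling ((+ (m * d)) ℚ./ k) ℤ.+ + m
CaseBound case4 m k d = ceiling ((+ (m * d)) ℚ./ k)

FloorBound : (m k d : ℕ) → .{{NonZero k}} → ℤ
FloorBound m k d = floor ((+ (m * d)) ℚ./ k)

GoodFactor : (G : Graph) (X : Subset (n G)) (m k : ℕ) .{{_ : NonZero k}} →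
             Case → Factor G → Factor G → Set
GoodFactor G X m k c M H =
  M ⊆ H × TreeConnected G m H ×
  (∀ v → v ∈ X → + deg G H v ℤ.≤ CaseBound c m k (deg G ⊤ v))

{-# OPTIONS --safe #-}
module Submission where

-- Call an edge set H sparse if every nonempty vertex set A spans at most m(|A| - 1) edges of H, and A tight in case of
-- equality. By Nash-Williams a sparse set with m(n - 1) edges splits into m spanning trees, and Δ(M) ≤ m makes M
-- sparse; so it suffices to find a sparse H ⊇ M with m(n - 1) edges and prescribed degree bounds h.
--
-- Take such an H, of any size, minimising total excess over h plus missing edges. An edge g ∉ H can be exchanged for
-- any edge of the least tight set B spanning both ends of g; by minimality of B, a vertex v ∈ B that is not an end of g
-- has more than m edges in B, so one of them lies outside M. As in the local search of Fürer and Raghavachari for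
-- minimum-degree spanning trees, one merges tight parts along such edges g: every vertex of a merged part can be
-- brought strictly below its bound by exchanges inside that part, so both ends of g can be relieved independently
-- before g is inserted. When no merger is possible, V is partitioned into tight parts, where the set S of vertices that
-- cannot be relieved consists of singletons, and all edges between different parts missing S belong to H. Comparing
-- the number of edges between parts in H and in G contradicts the connectivity of G unless H is as desired.

open import Defs
open import Data.Bool as Bool using (Bool; true; false; _∧_; _∨_; not; _xor_; if_then_else_)
open import Data.Bool.Properties
  using (T-∧; not-injective; ∧-comm; ∧-zeroʳ; ∧-identityʳ; ∨-identityʳ; xor-same)
open import Data.Empty using (⊥; ⊥-elim)
open import Data.Fin using (Fin; zero; suc; _≟_)
open import Data.Fin.Properties using (any?; all?)
import Data.Fin.Subset as Subset
open import Data.Fin.Subset using (Subset; _∈_; _⊆_; ⊤; _─_; ⁅_⁆; ∣_∣)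
open import Data.Fin.Subset.Properties using (_⊆?_; _∈?_)
open import Data.Integer as ℤ using (ℤ; +_; -[1+_])
import Data.Integer.DivMod as ℤ
import Data.Integer.GCD as ℤ
import Data.Integer.Properties as ℤ
import Data.Integer.Tactic.RingSolver as ℤ
open import Data.Nat hiding (_≟_)
open import Data.Nat.Properties hiding (_≟_)
open import Data.Nat.Tactic.RingSolver using (solve-∀)
open import Data.Product using (Σ; _×_; _,_; proj₁; proj₂)
open import Data.Rational as ℚ using (floor; ceiling; ↥_; ↧_)
import Data.Rational.Properties as ℚ
open import Data.Sum using (_⊎_; inj₁; inj₂)
open import Data.Unit as Unit using (tt)
open import Data.Vec using (Vec; []; _∷_; lookup; tabulate)
open import Data.Vec.Properties
  using ([]=⇒lookup; lookup⇒[]=; lookup∘tabulate; lookup-zipWith; lookup-replicate)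
open import Function using (_∘_; case_of_; Equivalence)
open import Relation.Binary.PropositionalEquality
open import Relation.Nullary
open import Relation.Nullary.Decidable using (decidable-stable; ¬¬-excluded-middle)
open import Algebra.Properties.Semiring.Sum +-*-semiring
  using (sum; sum-cong-≗; ∑-distrib-+; ∑-comm; *-distribˡ-sum)

-- Finite classical reasoning and counting

-- The final count leaves no room, and this fixes all constants. Let p be the number of parts, s =
-- |S|, and a the number of edges of H inside S. Tightness allows H at most m(p - 1) edges between
-- parts; in G, k-tree-connectivity gives at least k(p - 1) such edges, while k-edge-connectivity
-- gives each part outside S a boundary of at least k. Multiplying the count for H by k and
-- cancelling p leaves an error due to the edges inside S and, under edge-connectivity, also to the
-- parts in S, whose boundaries are not counted. Since S itself spans a sparse graph, a ≤ m(s - 1),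
-- and the error is at most s - 1 copies of the surplus of k times a vertex bound over m d(v). This
-- is where the terms 2m and m come from; if X is independent, a = 0 and less surplus is needed. As
-- s - 1 copies suffice, one vertex may forgo its surplus and even be rounded down, hence the floor
-- at u. Minima over undecided predicates exist only up to double negation, so the whole search runs
-- under one. It is left at the end, because the existence of a suitable factor is decidable by
-- finite search.

em : ∀ {p} {P : Set p} → (Dec P → ⊥) → ⊥
em = ¬¬-excluded-middle

-- Predicates such as being a stage of the search are not decided, hence the double negation; every
-- chain of uses ends in `⊥` or in a decidable goal. Largest sets are obtained by minimising the
-- size of the complement.
least : ∀ {a p} {A : Set a} (P : A → Set p) (μ : A → ℕ) {x : A} → P x →
        ¬ ¬ (Σ A λ y → P y × (∀ z → P z → μ y ≤ μ z))
least {A = A} P μ {x} px k = go (suc (μ x)) x px ≤-refl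
  where
  go : ∀ b x → P x → μ x < b → ⊥
  go (suc b) x px (s≤s x≤b) = em {P = Σ A λ z → P z × μ z < μ x} λ where
    (yes (z , pz , lt)) → go b z pz (<-≤-trans lt x≤b)
    (no none) → k (x , px , λ z pz → ≮⇒≥ λ lt → none (z , pz , lt))

decide-all : ∀ {p} n (P : Fin n → Set p) → ¬ ¬ (∀ i → Dec (P i))
decide-all zero P k = k λ ()
decide-all (suc n) P k = em λ d → decide-all n (P ∘ suc) λ ds →
  k λ { zero → d ; (suc i) → ds i }

false≢true : false ≢ true
false≢true ()

∧-true : ∀ {x y} → x ∧ y ≡ true → x ≡ true × y ≡ true
∧-true {true} {true} refl = refl , refl

true-∧ : ∀ {x y} → x ≡ true → y ≡ true → x ∧ y ≡ true
true-∧ refl refl = refl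

bool-ext : ∀ {x y} → (x ≡ true → y ≡ true) → (y ≡ true → x ≡ true) → x ≡ y
bool-ext {false} {false} f g = refl
bool-ext {false} {true} f g = g refl
bool-ext {true} f g = sym (f refl)

true-or-false : ∀ b → b ≡ true ⊎ b ≡ false
true-or-false true = inj₁ refl
true-or-false false = inj₂ refl

not-true : ∀ {x} → x ≢ true → x ≡ false
not-true {false} _ = refl
not-true {true} h = ⊥-elim (h refl)

Formula : ℕ → Set
Formula zero = Bool
Formula (suc k) = Bool → Formula k

valid : ∀ k → Formula k → Bool
valid zero P = P
valid (suc k) P = valid k (P true) ∧ valid k (P false)

Holds : ∀ k → Formula k → Set
Holds zero P = Bool.T P
Holds (suc k) P = ∀ b → Holds k (P b)

-- Proof by evaluation: on a closed formula `valid` computes, so `tt` suffices. Inequalities between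
-- counts are checked for a single edge or vertex from its membership bits and then summed.
truth-table : ∀ k (P : Formula k) → Bool.T (valid k P) → Holds k P
truth-table zero P h = h
truth-table (suc k) P h true = truth-table k _ (proj₁ (Equivalence.to T-∧ h))
truth-table (suc k) P h false = truth-table k _ (proj₂ (Equivalence.to (T-∧ {valid k (P true)}) h))

infix 8 ⟦_⟧
⟦_⟧ : Bool → ℕ
⟦ true ⟧ = 1
⟦ false ⟧ = 0

infix 4 _==_
_==_ : ∀ {n} → Fin n → Fin n → Bool
x == y = does (x ≟ y)

==-sound : ∀ {n} {x y : Fin n} → (x == y) ≡ true → x ≡ y
==-sound {x = x} {y} h with x ≟ y
... | yes p = p

==-refl : ∀ {n} (x : Fin n) → (x == x) ≡ true
==-refl x with x ≟ x
... | yes _ = refl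
... | no p = ⊥-elim (p refl)

==-complete : ∀ {n} {x y : Fin n} → x ≡ y → (x == y) ≡ true
==-complete {x = x} refl = ==-refl x

==-sym : ∀ {n} (x y : Fin n) → (x == y) ≡ (y == x)
==-sym x y = bool-ext {x == y} (λ p → ==-complete (sym (==-sound {x = x} p)))
    (λ p → ==-complete (sym (==-sound {x = y} p)))

≢⇒== : ∀ {n} {x y : Fin n} → x ≢ y → (x == y) ≡ false
≢⇒== h = not-true (h ∘ ==-sound)

∸-monoˡ-<′ : ∀ {x y} z → x < y → z < y → x ∸ z < y ∸ z
∸-monoˡ-<′ {x} {y} z x<y z<y with z ≤? x
... | yes z≤x = ∸-monoˡ-< x<y z≤x
... | no z≰x = subst (_< y ∸ z) (sym (m≤n⇒m∸n≡0 (<⇒≤ (≰⇒> z≰x)))) (m<n⇒0<n∸m z<y)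

sum-mono : ∀ {n} {f g : Fin n → ℕ} → (∀ i → f i ≤ g i) → sum f ≤ sum g
sum-mono {zero} h = z≤n
sum-mono {suc n} h = +-mono-≤ (h zero) (sum-mono (h ∘ suc))

sum-mono-< : ∀ {n} {f g : Fin n → ℕ} → (∀ i → f i ≤ g i) → ∀ j → f j < g j → sum f < sum g
sum-mono-< h zero lt = +-mono-<-≤ lt (sum-mono (h ∘ suc))
sum-mono-< h (suc j) lt = +-mono-≤-< (h zero) (sum-mono-< (h ∘ suc) j lt)

sum-+-mono : ∀ {n} {f g f' g' : Fin n → ℕ} → (∀ i → f i + g i ≤ f' i + g' i) →
             sum f + sum g ≤ sum f' + sum g'
sum-+-mono {f = f} {g} {f'} {g'} h =
  subst₂ _≤_ (∑-distrib-+ f g) (∑-distrib-+ f' g') (sum-mono h)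

sum-+-cong : ∀ {n} {f g f' g' : Fin n → ℕ} → (∀ i → f i + g i ≡ f' i + g' i) →
             sum f + sum g ≡ sum f' + sum g'
sum-+-cong h = ≤-antisym (sum-+-mono λ i → ≤-reflexive (h i)) (sum-+-mono λ i → ≤-reflexive (sym (h i)))

sum-cong : ∀ {n} {f g : Fin n → ℕ} → (∀ i → f i ≡ g i) → sum f ≡ sum g
sum-cong h = sum-cong-≗ h

sum-const : ∀ n c → sum {n} (λ _ → c) ≡ n * c
sum-const zero c = refl
sum-const (suc n) c = cong (λ x → c + x) (sum-const n c)

sum-zero : ∀ {n} {f : Fin n → ℕ} → (∀ i → f i ≡ 0) → sum f ≡ 0
sum-zero {zero} h = refl
sum-zero {suc n} h = cong₂ _+_ (h zero) (sum-zero (h ∘ suc))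

sum-≥ : ∀ {n} (f : Fin n → ℕ) i → f i ≤ sum f
sum-≥ f zero = m≤m+n _ _
sum-≥ f (suc i) = ≤-trans (sum-≥ (f ∘ suc) i) (m≤n+m _ _)

suc-== : ∀ {n} (x y : Fin n) → (suc x == suc y) ≡ (x == y)
suc-== x y with x ≟ y
... | yes _ = refl
... | no _ = refl

sum-delta : ∀ {n} (a : Fin n) (f : Fin n → ℕ) → sum (λ r → ⟦ a == r ⟧ * f r) ≡ f a
sum-delta zero f = trans (cong₂ _+_ (+-identityʳ _) (sum-zero {f = λ i → ⟦ zero == suc i ⟧ * f (suc i)} λ i → refl))
    (+-identityʳ _)
sum-delta (suc a) f = trans (sum-cong λ r → cong (λ b → ⟦ b ⟧ * f (suc r)) (suc-== a r)) (sum-delta a (f ∘ suc))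

size : ∀ {k} → (Fin k → Bool) → ℕ
size A = sum λ i → ⟦ A i ⟧

infix 4 _⊑_
_⊑_ : ∀ {k} → (Fin k → Bool) → (Fin k → Bool) → Set
A ⊑ B = ∀ i → A i ≡ true → B i ≡ true

⟦⟧-mono : ∀ {x y} → (x ≡ true → y ≡ true) → ⟦ x ⟧ ≤ ⟦ y ⟧
⟦⟧-mono {false} h = z≤n
⟦⟧-mono {true} h rewrite h refl = ≤-refl

⟦⟧-< : ∀ {x y} → x ≡ false → y ≡ true → ⟦ x ⟧ < ⟦ y ⟧
⟦⟧-< refl refl = ≤-refl

size-mono : ∀ {k} {A B : Fin k → Bool} → A ⊑ B → size A ≤ size B
size-mono h = sum-mono λ i → ⟦⟧-mono (h i)

size-mono-< : ∀ {k} {A B : Fin k → Bool} → A ⊑ B → ∀ v → A v ≡ false → B v ≡ true → size A < size B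
size-mono-< h v p q = sum-mono-< (λ i → ⟦⟧-mono (h i)) v (⟦⟧-< p q)

size-pos : ∀ {k} (A : Fin k → Bool) v → A v ≡ true → 1 ≤ size A
size-pos A v p = ≤-trans (≤-reflexive (cong ⟦_⟧ (sym p))) (sum-≥ (λ i → ⟦ A i ⟧) v)

size-witness : ∀ {k} (A : Fin k → Bool) → 1 ≤ size A → Σ (Fin k) λ v → A v ≡ true
size-witness {suc k} A h with A zero in eq
... | true = zero , eq
... | false with size-witness (A ∘ suc) h
... | v , p = suc v , p

⊑-antisym-size : ∀ {k} {A B : Fin k → Bool} → A ⊑ B → size B ≤ size A → B ⊑ A
⊑-antisym-size {A = A} h le v q with A v in eq
... | true = refl
... | false = ⊥-elim (<⇒≱ (size-mono-< h v eq q) le)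

size-full : ∀ n → size {n} (λ _ → true) ≡ n
size-full n = trans (sum-const n 1) (*-identityʳ n)

infixr 6 _∩_
infixr 5 _∪_
_∩_ _∪_ : ∀ {k} → (Fin k → Bool) → (Fin k → Bool) → Fin k → Bool
(A ∩ B) v = A v ∧ B v
(A ∪ B) v = A v ∨ B v

∁ : ∀ {k} → (Fin k → Bool) → Fin k → Bool
∁ A v = not (A v)

size-∪-∩ : ∀ {k} (A B : Fin k → Bool) → size A + size B ≡ size (A ∪ B) + size (A ∩ B)
size-∪-∩ A B = sum-+-cong λ i → ≡ᵇ⇒≡ _ _
  (truth-table 2 (λ a b → (⟦ a ⟧ + ⟦ b ⟧) ≡ᵇ (⟦ a ∨ b ⟧ + ⟦ a ∧ b ⟧)) tt (A i) (B i))

size-∁ : ∀ {k} (A : Fin k → Bool) → size A + size (∁ A) ≡ k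
size-∁ {k} A = trans (sym (∑-distrib-+ (λ i → ⟦ A i ⟧) (λ i → ⟦ ∁ A i ⟧)))
    (trans (sum-cong λ i → case (A i)) (size-full k))
  where
  case : ∀ b → ⟦ b ⟧ + ⟦ not b ⟧ ≡ 1
  case true = refl
  case false = refl

∪-introˡ : ∀ {x y} → x ≡ true → x ∨ y ≡ true
∪-introˡ refl = refl

∪-introʳ : ∀ {x y} → y ≡ true → x ∨ y ≡ true
∪-introʳ {false} refl = refl
∪-introʳ {true} refl = refl

∪-elim : ∀ {x y} → x ∨ y ≡ true → x ≡ true ⊎ y ≡ true
∪-elim {true} h = inj₁ refl
∪-elim {false} h = inj₂ h

∪-⊑ : ∀ {k} {A B C : Fin k → Bool} → A ⊑ C → B ⊑ C → (A ∪ B) ⊑ C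
∪-⊑ {A = A} f g v p with ∪-elim {A v} p
... | inj₁ q = f v q
... | inj₂ q = g v q

⟨_⟩ : ∀ {k} → Fin k → Fin k → Bool
⟨ v ⟩ w = v == w

size-⟨⟩ : ∀ {k} (v : Fin k) → size ⟨ v ⟩ ≡ 1
size-⟨⟩ v = trans (sum-cong {f = λ i → ⟦ ⟨ v ⟩ i ⟧} (λ r → sym (*-identityʳ ⟦ v == r ⟧))) (sum-delta v (λ _ → 1))

size-cong : ∀ {k} {A B : Fin k → Bool} → (∀ i → A i ≡ B i) → size A ≡ size B
size-cong h = sum-cong λ i → cong ⟦_⟧ (h i)

size-gap : ∀ {k} {A B : Fin k → Bool} → size B < size A → Σ (Fin k) λ i → A i ≡ true × B i ≡ false
size-gap {k} {A} {B} lt with size-witness (A ∩ ∁ B) (+-cancelˡ-≤ (size B) 1 _ bound)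
  where
  bound : size B + 1 ≤ size B + size (A ∩ ∁ B)
  bound = ≤-trans (≤-reflexive (+-comm _ 1)) (≤-trans lt (subst (size A ≤_)
    (∑-distrib-+ (λ i → ⟦ B i ⟧) (λ i → ⟦ (A ∩ ∁ B) i ⟧))
    (sum-mono λ i → ≤ᵇ⇒≤ _ _ (truth-table 2 (λ a b → ⟦ a ⟧ ≤ᵇ (⟦ b ⟧ + ⟦ a ∧ not b ⟧)) tt (A i) (B i)))))
... | i , p = i , proj₁ (∧-true p) , not-injective (proj₂ (∧-true {A i} p))

size-insert : ∀ {k} (H P : Fin k → Bool) g → H g ≡ false →
              size ((H ∪ ⟨ g ⟩) ∩ P) ≡ size (H ∩ P) + ⟦ P g ⟧
size-insert {k} H P g h = trans (sum-cong point)
  (trans (∑-distrib-+ (λ i → ⟦ (H ∩ P) i ⟧) (λ i → ⟦ g == i ⟧ * ⟦ P i ⟧))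
      (cong (λ x → size (H ∩ P) + x) (sum-delta g _)))
  where
  point : ∀ i → ⟦ ((H ∪ ⟨ g ⟩) ∩ P) i ⟧ ≡ ⟦ (H ∩ P) i ⟧ + ⟦ g == i ⟧ * ⟦ P i ⟧
  point i with g ≟ i
  ... | no _ = ≡ᵇ⇒≡ _ _ (truth-table 2 (λ h p → ⟦ (h ∨ false) ∧ p ⟧ ≡ᵇ (⟦ h ∧ p ⟧ + 0)) tt (H i) (P i))
  ... | yes refl rewrite h = sym (+-identityʳ _)

size-delete : ∀ {k} (H P : Fin k → Bool) f → H f ≡ true →
              size ((H ∩ ∁ ⟨ f ⟩) ∩ P) + ⟦ P f ⟧ ≡ size (H ∩ P)
size-delete {k} H P f h = trans (cong (λ x → size ((H ∩ ∁ ⟨ f ⟩) ∩ P) + x) (sym (sum-delta f _)))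
  (trans (sym (∑-distrib-+ (λ i → ⟦ ((H ∩ ∁ ⟨ f ⟩) ∩ P) i ⟧) (λ i → ⟦ f == i ⟧ * ⟦ P i ⟧))) (sum-cong point))
  where
  point : ∀ i → ⟦ ((H ∩ ∁ ⟨ f ⟩) ∩ P) i ⟧ + ⟦ f == i ⟧ * ⟦ P i ⟧ ≡ ⟦ (H ∩ P) i ⟧
  point i with f ≟ i
  ... | no _ = ≡ᵇ⇒≡ _ _ (truth-table 2 (λ h p → (⟦ (h ∧ true) ∧ p ⟧ + 0) ≡ᵇ ⟦ h ∧ p ⟧) tt (H i) (P i))
  ... | yes refl rewrite h = +-identityʳ _

exchange : ∀ {k} → (Fin k → Bool) → Fin k → Fin k → Fin k → Bool
exchange H g f = (H ∪ ⟨ g ⟩) ∩ ∁ ⟨ f ⟩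

-- One identity for sizes, spans and degrees: `P` becomes `within A` or `at v`. It is additive
-- because subtraction truncates.
size-exchange : ∀ {k} (H P : Fin k → Bool) g f → H g ≡ false → H f ≡ true →
            size (exchange H g f ∩ P) + ⟦ P f ⟧ ≡ size (H ∩ P) + ⟦ P g ⟧
size-exchange H P g f hg hf = trans (size-delete (H ∪ ⟨ g ⟩) P f (∪-introˡ hf)) (size-insert H P g hg)

-- Sparse edge sets and tight vertex sets

module Sparsity (G : Graph) where

  VSet ESet : Set
  VSet = Fin (n G) → Bool
  ESet = Fin (e G) → Bool

  src tgt : Fin (e G) → Fin (n G)
  src i = proj₁ (ends G i)
  tgt i = proj₂ (ends G i)

  within : VSet → ESet
  within A i = A (src i) ∧ A (tgt i)

  at : Fin (n G) → ESet
  at v i = (src i == v) ∨ (tgt i == v)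

  full : VSet
  full _ = true

  edges : ESet → VSet → ℕ
  edges H A = size (H ∩ within A)

  degree : ESet → Fin (n G) → ℕ
  degree H v = size (H ∩ at v)

  -- The `m` stands on the left to avoid truncated subtraction. The member `v` excludes the empty
  -- set, for which the inequality fails once `m` is positive.
  record Sparse (m : ℕ) (H : ESet) : Set where
    constructor mkSparse
    field bound : ∀ A v → A v ≡ true → edges H A + m ≤ m * size A

  record Tight (m : ℕ) (H : ESet) (A : VSet) : Set where
    constructor mkTight
    field
      inhabited : Σ (Fin (n G)) λ v → A v ≡ true
      saturated : m * size A ≤ edges H A + m

  open Sparse public
  open Tight public

  within-src : ∀ A i → within A i ≡ true → A (src i) ≡ true
  within-src A i p = proj₁ (∧-true {A (src i)} p)

  within-tgt : ∀ A i → within A i ≡ true → A (tgt i) ≡ true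
  within-tgt A i p = proj₂ (∧-true {A (src i)} p)

  within-mono : ∀ {A B} → A ⊑ B → within A ⊑ within B
  within-mono {A} h i p = true-∧ (h _ (within-src A i p)) (h _ (within-tgt A i p))

  edges-cong : ∀ {H H' A B} → (∀ i → H i ≡ H' i) → (∀ v → A v ≡ B v) → edges H A ≡ edges H' B
  edges-cong h k = size-cong λ i → cong₂ _∧_ (h i) (cong₂ _∧_ (k _) (k _))

  sparse-cong : ∀ {m H H'} → (∀ i → H i ≡ H' i) → Sparse m H → Sparse m H'
  sparse-cong {m} {H} h sp = mkSparse λ A v p →
    subst (λ x → x + m ≤ m * size A) (edges-cong {H} {A = A} h λ _ → refl) (bound sp A v p)

  tight-cong : ∀ {m H H' A B} → (∀ i → H i ≡ H' i) → (∀ v → A v ≡ B v) → Tight m H A → Tight m H' B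
  tight-cong {m} {H} {A = A} h k (mkTight (v , p) c) = mkTight (v , trans (sym (k v)) p)
    (subst₂ (λ x y → m * x ≤ y + m) (size-cong k) (edges-cong {H} {A = A} h k) c)

  -- An edge joining `A` minus `B` to `B` minus `A` is seen by the union only; every other edge
  -- contributes equally to both sides.
  edges-supermodular : ∀ H A B → edges H A + edges H B ≤ edges H (A ∪ B) + edges H (A ∩ B)
  edges-supermodular H A B = sum-+-mono λ i → ≤ᵇ⇒≤ _ _
    (truth-table 5 (λ h a a' b b' → (⟦ h ∧ a ∧ a' ⟧ + ⟦ h ∧ b ∧ b' ⟧) ≤ᵇ
        (⟦ h ∧ (a ∨ b) ∧ (a' ∨ b') ⟧ + ⟦ h ∧ (a ∧ b) ∧ (a' ∧ b') ⟧)) tt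
      (H i) (A (src i)) (A (tgt i)) (B (src i)) (B (tgt i)))

  private
    -- Two tight sets attain their bounds and supermodularity leaves no room, so union and
    -- intersection attain theirs. `p` and `q` are the sizes of these two in either order, which
    -- serves both closure lemmas.
    uncross : ∀ m {a b u i x y p q} → x + y ≡ p + q → m * x ≤ a + m → m * y ≤ b + m →
              a + b ≤ u + i → i + m ≤ m * q → m * p ≤ u + m
    uncross m {a} {b} {u} {i} {x} {y} {p} {q} eq hx hy hs hi = +-cancelʳ-≤ (m * q) _ _ (begin
      m * p + m * q ≡⟨ *-distribˡ-+ m p q ⟨
      m * (p + q) ≡⟨ cong (m *_) eq ⟨
      m * (x + y) ≡⟨ *-distribˡ-+ m x y ⟩
      m * x + m * y ≤⟨ +-mono-≤ hx hy ⟩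
      (a + m) + (b + m) ≡⟨ r1 a b m ⟩
      (a + b) + (m + m) ≤⟨ +-monoˡ-≤ (m + m) hs ⟩
      (u + i) + (m + m) ≡⟨ r2 u i m ⟩
      (u + m) + (i + m) ≤⟨ +-monoʳ-≤ (u + m) hi ⟩
      (u + m) + m * q ∎)
      where
      open ≤-Reasoning
      r1 : ∀ a b m → (a + m) + (b + m) ≡ (a + b) + (m + m)
      r1 = solve-∀
      r2 : ∀ u i m → (u + i) + (m + m) ≡ (u + m) + (i + m)
      r2 = solve-∀

  tight-∪ : ∀ {m H A B} v → Sparse m H → Tight m H A → Tight m H B → A v ≡ true → B v ≡ true → Tight m H (A ∪ B)
  tight-∪ {m} {H} {A} {B} v sp ta tb av bv = mkTight (v , ∪-introˡ av)
    (uncross m (size-∪-∩ A B) (saturated ta) (saturated tb) (edges-supermodular H A B)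
        (bound sp (A ∩ B) v (true-∧ av bv)))

  tight-∩ : ∀ {m H A B} v → Sparse m H → Tight m H A → Tight m H B → A v ≡ true → B v ≡ true → Tight m H (A ∩ B)
  tight-∩ {m} {H} {A} {B} v sp ta tb av bv = mkTight (v , true-∧ av bv)
    (uncross m (trans (size-∪-∩ A B) (+-comm (size (A ∪ B)) _)) (saturated ta) (saturated tb)
      (≤-trans (edges-supermodular H A B) (≤-reflexive (+-comm (edges H (A ∪ B)) _)))
          (bound sp (A ∪ B) v (∪-introˡ av)))

  sparse-insert : ∀ {m H} g → Sparse m H → H g ≡ false →
                  (∀ A → Tight m H A → within A g ≡ true → ⊥) → Sparse m (H ∪ ⟨ g ⟩)
  sparse-insert {m} {H} g sp hg free = mkSparse λ A v av →
    subst (λ x → x + m ≤ m * size A) (sym (size-insert H (within A) g hg)) (go A v av)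
    where
    go : ∀ A v → A v ≡ true → edges H A + ⟦ within A g ⟧ + m ≤ m * size A
    go A v av with within A g in eq
    ... | false = subst (λ x → x + m ≤ m * size A) (sym (+-identityʳ _)) (bound sp A v av)
    ... | true = subst (λ x → x + m ≤ m * size A) (+-comm 1 (edges H A)) (≰⇒> λ le → free A (mkTight (v , av) le) eq)

  -- In the matroid of sparse edge sets, if `H` is sparse and misses `g`, then `g` and the edges of
  -- `H` inside `B` form the fundamental circuit of `g`.
  MinTight : ℕ → ESet → Fin (e G) → VSet → Set
  MinTight m H g B = (Tight m H B × within B g ≡ true) × (∀ C → Tight m H C × within C g ≡ true → size B ≤ size C)

  -- Both sets contain the ends of `g`, so their intersection is tight and spans `g`; being no
  -- smaller than `B`, it is `B`.
  minTight-⊑ : ∀ {m H g B A} → Sparse m H → MinTight m H g B → Tight m H A → within A g ≡ true → B ⊑ A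
  minTight-⊑ {m} {H} {g} {B} {A} sp ((tB , gB) , mn) tA gA v p =
    proj₂ (∧-true {B v} (⊑-antisym-size {A = B ∩ A} {B} (λ i q → proj₁ (∧-true {B i} q))
      (mn (B ∩ A) (tight-∩ (src g) sp tB tA (within-src B g gB) (within-src A g gA) ,
        true-∧ (true-∧ (within-src B g gB) (within-src A g gA)) (true-∧ (within-tgt B g gB) (within-tgt A g gA)))) v p))

  -- Only a tight set spanning `g` could become overfull, and such a set contains `B`, hence loses
  -- `f` as well.
  sparse-exchange : ∀ {m H B} g f → Sparse m H → H g ≡ false → MinTight m H g B →
                    H f ≡ true → within B f ≡ true → Sparse m (exchange H g f)
  sparse-exchange {m} {H} {B} g f sp hg mt hf fB = mkSparse go
    where
    H' = exchange H g f
    go : ∀ A v → A v ≡ true → edges H' A + m ≤ m * size A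
    go A v av with within A g in eq | size-exchange H (within A) g f hg hf
    ... | false | c = ≤-trans (+-monoˡ-≤ m (m+n≤o⇒m≤o (edges H' A)
        (≤-reflexive (trans c (+-identityʳ (edges H A)))))) (bound sp A v av)
    ... | true | c with m * size A ≤? edges H A + m
    ... | no nt = ≤-trans (+-monoˡ-≤ m (m+n≤o⇒m≤o (edges H' A) (≤-reflexive (trans c (+-comm (edges H A) 1))))) (≰⇒> nt)
    ... | yes t = subst (λ x → x + m ≤ m * size A) (sym (+-cancelʳ-≡ 1 (edges H' A) (edges H A) same)) (bound sp A v av)
      where
      same : edges H' A + 1 ≡ edges H A + 1
      same = subst (λ b → edges H' A + ⟦ b ⟧ ≡ edges H A + 1)
               (within-mono {B} {A} (minTight-⊑ sp mt (mkTight (v , av) t) eq) f fB) c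

  graft : VSet → ESet → ESet → ESet
  graft K J H i = if within K i then J i else H i

  -- Since m |A ∪ K| - m |K| bounds the edges of A outside the tight set K, the part inside K can be replaced freely.
  sparse-graft : ∀ {m H J K} → Sparse m H → Sparse m J → Tight m H K → Sparse m (graft K J H)
  sparse-graft {m} {H} {J} {K} spH spJ tK = mkSparse go
    where
    open ≤-Reasoning
    go : ∀ A v → A v ≡ true → edges (graft K J H) A + m ≤ m * size A
    go A v av with any? (λ w → (A ∩ K) w Bool.≟ true)
    ... | no none = ≤-trans (+-monoˡ-≤ m (size-mono point)) (bound spH A v av)
      where
      point : (graft K J H ∩ within A) ⊑ (H ∩ within A)
      point i p with within K i in eq
      ... | false = p
      ... | true = ⊥-elim (none (src i , true-∧ (within-src A i (proj₂ (∧-true {J i} p))) (within-src K i eq)))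
    ... | yes (w , wAK) = +-cancelʳ-≤ (edges H K + m) _ _ (begin
      edges (graft K J H) A + m + (edges H K + m) ≡⟨ r1 (edges (graft K J H) A) (edges H K) m ⟩
      (edges (graft K J H) A + edges H K) + (m + m) ≤⟨ +-monoˡ-≤ (m + m) count ⟩
      (edges H (A ∪ K) + edges J (A ∩ K)) + (m + m) ≡⟨ r2 (edges H (A ∪ K)) _ m ⟩
      (edges H (A ∪ K) + m) + (edges J (A ∩ K) + m) ≤⟨ +-mono-≤
          (bound spH (A ∪ K) w (∪-introˡ (proj₁ (∧-true {A w} wAK)))) (bound spJ (A ∩ K) w wAK) ⟩
      m * size (A ∪ K) + m * size (A ∩ K) ≡⟨ *-distribˡ-+ m (size (A ∪ K)) _ ⟨
      m * (size (A ∪ K) + size (A ∩ K)) ≡⟨ cong (m *_) (size-∪-∩ A K) ⟨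
      m * (size A + size K) ≡⟨ *-distribˡ-+ m (size A) _ ⟩
      m * size A + m * size K ≤⟨ +-monoʳ-≤ (m * size A) (saturated tK) ⟩
      m * size A + (edges H K + m) ∎)
      where
      r1 : ∀ a b m → a + m + (b + m) ≡ (a + b) + (m + m)
      r1 = solve-∀
      r2 : ∀ u i m → (u + i) + (m + m) ≡ (u + m) + (i + m)
      r2 = solve-∀
      count : edges (graft K J H) A + edges H K ≤ edges H (A ∪ K) + edges J (A ∩ K)
      count = sum-+-mono λ i → ≤ᵇ⇒≤ _ _ (truth-table 6
        (λ h j a a' k k' → (⟦ (if k ∧ k' then j else h) ∧ a ∧ a' ⟧ + ⟦ h ∧ k ∧ k' ⟧) ≤ᵇ
            (⟦ h ∧ (a ∨ k) ∧ (a' ∨ k') ⟧ + ⟦ j ∧ (a ∧ k) ∧ (a' ∧ k') ⟧)) tt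
        (H i) (J i) (A (src i)) (A (tgt i)) (K (src i)) (K (tgt i)))

  AgreeOff : VSet → ESet → ESet → Set
  AgreeOff K H' H = ∀ i → within K i ≡ false → H' i ≡ H i

  edges-agreeOff : ∀ {K W H H'} → AgreeOff K H' H → edges H' K ≡ edges H K → K ⊑ W → edges H' W ≡ edges H W
  edges-agreeOff {K} {W} {H} {H'} ag eq K⊑W = +-cancelʳ-≡ (edges H K) _ _
    (trans (sum-+-cong point) (cong (λ x → edges H W + x) eq))
    where
    point : ∀ i → ⟦ (H' ∩ within W) i ⟧ + ⟦ (H ∩ within K) i ⟧ ≡ ⟦ (H ∩ within W) i ⟧ + ⟦ (H' ∩ within K) i ⟧
    point i with within K i in inK
    ... | true rewrite within-mono {K} {W} K⊑W i inK = +-comm ⟦ H' i ∧ true ⟧ _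
    ... | false rewrite ag i inK = cong (λ x → ⟦ (H ∩ within W) i ⟧ + x)
        (≡ᵇ⇒≡ _ _ (truth-table 1 (λ h → ⟦ h ∧ false ⟧ ≡ᵇ ⟦ h ∧ false ⟧) tt (H i)))

  Disjoint : VSet → VSet → Set
  Disjoint A B = ∀ v → A v ≡ true → B v ≡ true → ⊥

  edges-agreeOff-disjoint : ∀ {K W H H'} → AgreeOff K H' H → Disjoint K W → edges H' W ≡ edges H W
  edges-agreeOff-disjoint {K} {W} {H} {H'} ag dj = size-cong point
    where
    point : ∀ i → (H' ∩ within W) i ≡ (H ∩ within W) i
    point i with within K i in inK
    ... | false rewrite ag i inK = refl
    ... | true with W (src i) in eq
    ... | true = ⊥-elim (dj _ (within-src K i inK) eq)
    ... | false = trans (∧-zeroʳ (H' i)) (sym (∧-zeroʳ (H i)))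

  at-outside : ∀ {K v} i → K v ≡ false → at v i ≡ true → within K i ≡ false
  at-outside {K} {v} i kv p = not-true λ w → case ∪-elim p of λ where
    (inj₁ q) → false≢true (trans (sym kv) (trans (cong K (sym (==-sound q))) (within-src K i w)))
    (inj₂ q) → false≢true (trans (sym kv) (trans (cong K (sym (==-sound q))) (within-tgt K i w)))

  degree-local : ∀ {H H'} v → (∀ i → at v i ≡ true → H' i ≡ H i) → degree H' v ≡ degree H v
  degree-local {H} {H'} v h = size-cong point
    where
    point : ∀ i → (H' ∩ at v) i ≡ (H ∩ at v) i
    point i with at v i in eq
    ... | true rewrite h i eq = refl
    ... | false = trans (∧-zeroʳ (H' i)) (sym (∧-zeroʳ (H i)))

  degree-agreeOff : ∀ {K H H'} v → AgreeOff K H' H → K v ≡ false → degree H' v ≡ degree H v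
  degree-agreeOff {K} v ag kv = degree-local v λ i p → ag i (at-outside {K} i kv p)

  -- Removing v from B leaves a set that still spans g, hence is not tight by minimality.
  minTight-degree : ∀ {m H g B} v → Sparse m H → MinTight m H g B → B v ≡ true → at v g ≡ false →
                    m < size (H ∩ within B ∩ at v)
  minTight-degree {m} {H} {g} {B} v sp ((tB , gB) , mn) bv vg = +-cancelˡ-≤ (edges H B' + m) _ _ (begin
      edges H B' + m + suc m ≡⟨ r1 (edges H B') m ⟩
      suc (edges H B' + m) + m ≤⟨ +-monoˡ-≤ m (≰⇒> λ le → <⇒≱ smaller
          (mn B' (mkTight (src g , inB' (src g) (within-src B g gB) vg1) le , gB'))) ⟩
      m * size B' + m ≡⟨ r2 m (size B') ⟩
      m * suc (size B') ≡⟨ cong (m *_) sizeB ⟩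
      m * size B ≤⟨ saturated tB ⟩
      edges H B + m ≡⟨ cong (_+ m) split ⟩
      edges H B' + size (H ∩ within B ∩ at v) + m ≡⟨ r3 (edges H B') _ m ⟩
      edges H B' + m + size (H ∩ within B ∩ at v) ∎)
    where
    open ≤-Reasoning
    r1 : ∀ a m → a + m + suc m ≡ suc (a + m) + m
    r1 = solve-∀
    r2 : ∀ m b → m * b + m ≡ m * suc b
    r2 = solve-∀
    r3 : ∀ a b m → a + b + m ≡ a + m + b
    r3 = solve-∀
    B' = B ∩ ∁ ⟨ v ⟩
    vg1 : src g ≢ v
    vg1 p = false≢true (trans (sym vg) (∪-introˡ (==-complete p)))
    vg2 : tgt g ≢ v
    vg2 p = false≢true (trans (sym vg) (∪-introʳ (==-complete p)))
    inB' : ∀ w → B w ≡ true → w ≢ v → B' w ≡ true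
    inB' w bw ne = true-∧ bw (cong not (≢⇒== (ne ∘ sym)))
    gB' : within B' g ≡ true
    gB' = true-∧ (inB' _ (within-src B g gB) vg1) (inB' _ (within-tgt B g gB) vg2)
    sizeB : suc (size B') ≡ size B
    sizeB = trans (+-comm 1 (size B')) (trans (cong (_+ 1) (size-cong λ i → sym (∧-identityʳ (B' i))))
      (trans (size-delete B full v bv) (size-cong λ i → ∧-identityʳ (B i))))
    smaller : size B' < size B
    smaller = ≤-reflexive sizeB
    split : edges H B ≡ edges H B' + size (H ∩ within B ∩ at v)
    split = trans (sum-cong λ i → point i) (∑-distrib-+ (λ i → ⟦ (H ∩ within B') i ⟧)
        (λ i → ⟦ (H ∩ within B ∩ at v) i ⟧))
      where
      point : ∀ i → ⟦ (H ∩ within B) i ⟧ ≡ ⟦ (H ∩ within B') i ⟧ + ⟦ (H ∩ within B ∩ at v) i ⟧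
      point i rewrite ==-sym v (src i) | ==-sym v (tgt i) = ≡ᵇ⇒≡ _ _ (truth-table 5
        (λ h b b' p q → ⟦ h ∧ b ∧ b' ⟧ ≡ᵇ (⟦ h ∧ (b ∧ not p) ∧ (b' ∧ not q) ⟧ + ⟦ h ∧ (b ∧ b') ∧ (p ∨ q) ⟧)) tt
        (H i) (B (src i)) (B (tgt i)) (src i == v) (tgt i == v))

  minTight-exchangeable : ∀ {m H M g B} v → Sparse m H → MinTight m H g B → B v ≡ true → at v g ≡ false →
                          degree M v ≤ m → Σ (Fin (e G)) λ f → H f ≡ true × within B f ≡ true × at v f ≡ true × M f ≡ false
  minTight-exchangeable {m} {H} {M} {g} {B} v sp mt bv vg dM
    with size-gap {A = H ∩ within B ∩ at v} {B = M ∩ at v} (≤-<-trans dM (minTight-degree v sp mt bv vg))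
  ... | f , p , q = f , proj₁ (∧-true {H f} p) , proj₁ (∧-true {within B f} (proj₂ (∧-true {H f} p))) , vf ,
        trans (sym (∧-identityʳ (M f))) (subst (λ b → M f ∧ b ≡ false) vf q)
    where
    vf = proj₂ (∧-true {within B f} (proj₂ (∧-true {H f} p)))

-- The Nash-Williams decomposition into forests

module Arboricity (G : Graph) where

  open Sparsity G

  sparse-⊑ : ∀ {m H H'} → H' ⊑ H → Sparse m H → Sparse m H'
  sparse-⊑ {m} {H} {H'} sub sp = mkSparse λ A v av → ≤-trans
    (+-monoˡ-≤ m (size-mono {A = H' ∩ within A} λ i p → true-∧ (sub i (proj₁ (∧-true {H' i} p)))
        (proj₂ (∧-true {H' i} p))))
    (bound sp A v av)

  colourClass : ∀ {m} → ESet → (Fin (e G) → Fin m) → Fin m → ESet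
  colourClass H c j i = H i ∧ (c i == j)

  ForestColouring : ℕ → ESet → Set
  ForestColouring m H = Σ (Fin (e G) → Fin m) λ c → ∀ j → Sparse 1 (colourClass H c j)

  -- A colouring of H minus one edge, the hole, is modified by moving the hole along circuits of the colour classes.
  -- If it never becomes possible to colour the hole, the ends of all reachable holes form a set that every class
  -- spans, and together with the hole H has too many edges there.
  module Augment (m : ℕ) (H : ESet) (spH : Sparse m H)
                 (c₀ : Fin (e G) → Fin m) (g₀ : Fin (e G)) (Hg₀ : H g₀ ≡ true) where

    F : (Fin (e G) → Fin m) → Fin (e G) → Fin m → ESet
    F c g j i = (H i ∧ not (g == i)) ∧ (c i == j)

    recolour : (Fin (e G) → Fin m) → Fin (e G) → Fin m → Fin (e G) → Fin m
    recolour c g j i = if g == i then j else c i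

    -- Augmenting walks as in matroid union: the hole `g` receives colour `j`, and an edge `f` of
    -- the circuit it closes in that class becomes the new hole. The colour stored at a hole is
    -- irrelevant, since `F` leaves the hole out.
    data Reachable : (Fin (e G) → Fin m) → Fin (e G) → Set where
      initial : Reachable c₀ g₀
      move : ∀ {c g} → Reachable c g → ∀ j A → MinTight 1 (F c g j) g A → ∀ f →
             F c g j f ≡ true → within A f ≡ true → Reachable (recolour c g j) f

    F-hole : ∀ c g j → F c g j g ≡ false
    F-hole c g j rewrite ==-refl g | ∧-zeroʳ (H g) = refl

    F-H : ∀ c g j f → F c g j f ≡ true → H f ≡ true
    F-H c g j f p = proj₁ (∧-true {H f} (proj₁ (∧-true {H f ∧ not (g == f)} p)))

    F-colour : ∀ c g j f → F c g j f ≡ true → c f ≡ j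
    F-colour c g j f p = ==-sound (proj₂ (∧-true {H f ∧ not (g == f)} p))

    module _ (c : Fin (e G) → Fin m) (g : Fin (e G)) (j : Fin m) (Hg : H g ≡ true) where

      class-same : ∀ i → (F c g j ∪ ⟨ g ⟩) i ≡ colourClass H (recolour c g j) j i
      class-same i with g ≟ i
      ... | yes refl rewrite Hg | ==-refl j = refl
      ... | no _ rewrite ∧-identityʳ (H i) = ∨-identityʳ _

      class-other : ∀ {j'} → j ≢ j' → ∀ i → F c g j' i ≡ colourClass H (recolour c g j) j' i
      class-other {j'} ne i with g ≟ i
      ... | yes refl rewrite Hg | ≢⇒== ne = refl
      ... | no _ rewrite ∧-identityʳ (H i) = refl

      F-same : ∀ f i → exchange (F c g j) g f i ≡ F (recolour c g j) f j i
      F-same f i = trans (cong (_∧ not (f == i)) (class-same i)) (truth (H i) (recolour c g j i == j) (not (f == i)))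
        where
        truth : ∀ x y z → (x ∧ y) ∧ z ≡ (x ∧ z) ∧ y
        truth true y z = ∧-comm y z
        truth false y z = refl

      F-other : ∀ {j'} → j ≢ j' → ∀ f → F c g j f ≡ true → ∀ i → F c g j' i ≡ F (recolour c g j) f j' i
      F-other {j'} ne f ff i with f ≟ i
      ... | no _ = trans (class-other ne i) (cong (_∧ (recolour c g j i == j')) (sym (∧-identityʳ (H i))))
      ... | yes refl rewrite ∧-zeroʳ (H i) | F-colour c g j i ff | ≢⇒== ne = ∧-zeroʳ _

    module _ (sp₀ : ∀ j → Sparse 1 (F c₀ g₀ j)) (stuck : ¬ ForestColouring m H) where

      hole : ∀ {c g} → Reachable c g → H g ≡ true
      hole initial = Hg₀
      hole (move {c} {g} r j A mt f ff _) = F-H c g j f ff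

      classes : ∀ {c g} → Reachable c g → ∀ j → Sparse 1 (F c g j)
      classes initial = sp₀
      classes (move {c} {g} r j A mt f ff fA) j' with j ≟ j'
      ... | yes refl = sparse-cong (F-same c g j (hole r) f) (sparse-exchange g f (classes r j) (F-hole c g j) mt ff fA)
      ... | no ne = sparse-cong (F-other c g j (hole r) ne f ff) (classes r j')

      -- Otherwise the hole could receive colour `j`, which would complete a forest colouring
      -- against `stuck`.
      circuit : ∀ {c g} → Reachable c g → ∀ j → ¬ ¬ Σ VSet (MinTight 1 (F c g j) g)
      circuit {c} {g} r j k = em {P = Σ VSet λ A → Tight 1 (F c g j) A × within A g ≡ true} λ where
          (yes (A , p)) → least (λ A → Tight 1 (F c g j) A × within A g ≡ true) size p k
          (no none) → stuck (recolour c g j , extended none)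
        where
        extended : ¬ (Σ VSet λ A → Tight 1 (F c g j) A × within A g ≡ true) → ∀ j' → Sparse 1
            (colourClass H (recolour c g j) j')
        extended none j' with j ≟ j'
        ... | yes refl = sparse-cong (class-same c g j (hole r))
            (sparse-insert g (classes r j) (F-hole c g j) λ A t w → none (A , t , w))
        ... | no ne = sparse-cong (class-other c g j (hole r) ne) (classes r j')

      HoleEnd : Fin (n G) → Set
      HoleEnd v = Σ (Fin (e G) → Fin m) λ c → Σ (Fin (e G)) λ f → Reachable c f × at v f ≡ true

      module _ (holeEnd? : ∀ v → Dec (HoleEnd v)) where

        C : VSet
        C v = does (holeEnd? v)

        C-intro : ∀ {c f} v → Reachable c f → at v f ≡ true → C v ≡ true
        C-intro v r p with holeEnd? v
        ... | yes _ = refl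
        ... | no q = ⊥-elim (q (_ , _ , r , p))

        C-elim : ∀ v → C v ≡ true → HoleEnd v
        C-elim v p with holeEnd? v
        ... | yes q = q

        -- By minimality, a vertex of `A` that is no end of `g` meets an edge of the class inside
        -- `A`, and that edge can be the next hole.
        circuit-⊑ : ∀ {c g} → Reachable c g → ∀ j {A} → MinTight 1 (F c g j) g A → A ⊑ C
        circuit-⊑ {c} {g} r j {A} mt v av with at v g in eq
        ... | true = C-intro v r eq
        ... | false with size-witness (F c g j ∩ within A ∩ at v) (<⇒≤ (minTight-degree v (classes r j) mt av eq))
        ... | f , p = C-intro v (move r j A mt f (proj₁ (∧-true {F c g j f} p)) (proj₁ (∧-true {within A f} q)))
            (proj₂ (∧-true {within A f} q))
          where
          q = proj₂ (∧-true {F c g j f} p)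

        -- Moves are undone one at a time. A tight set disjoint from the span `A` of the circuit has
        -- the same count before the move; one that meets `A` is joined to it, and as `A ∪ B` spans
        -- both `g` and `f`, its count does not change.
        backtrack : ∀ {c g} → Reachable c g → ∀ j B → Tight 1 (F c g j) B → B ⊑ C →
                    Σ VSet λ B' → Tight 1 (F c₀ g₀ j) B' × B ⊑ B' × B' ⊑ C
        backtrack initial j B t sub = B , t , (λ _ p → p) , sub
        backtrack (move {c} {g} r j A mt f ff fA) j' B t sub with j ≟ j'
        ... | no ne = backtrack r j' B (tight-cong (λ i → sym (F-other c g j (hole r) ne f ff i)) (λ _ → refl) t) sub
        ... | yes refl with any? (λ w → (A ∩ B) w Bool.≟ true)
        ... | no none = backtrack r j B (mkTight (inhabited t)
            (subst (λ x → 1 * size B ≤ x + 1) same (saturated t))) sub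
          where
          missed : ∀ h → within A h ≡ true → within B h ≡ false
          missed h p = not-true λ q → none (src h , true-∧ (within-src A h p) (within-src B h q))
          same : edges (F (recolour c g j) f j) B ≡ edges (F c g j) B
          same = +-cancelʳ-≡ 0 _ _ (trans (cong (_+ 0)
              (edges-cong {A = B} (λ i → sym (F-same c g j (hole r) f i)) λ _ → refl))
            (subst₂ (λ x y → edges (exchange (F c g j) g f) B + ⟦ x ⟧ ≡ edges (F c g j) B + ⟦ y ⟧) (missed f fA)
              (missed g (proj₂ (proj₁ mt))) (size-exchange (F c g j) (within B) g f (F-hole c g j) ff)))
        ... | yes (w , wAB) = case backtrack r j (A ∪ B) joined (∪-⊑ (circuit-⊑ r j mt) sub) of λ
                { (B' , t' , sub' , inC) → B' , t' , (λ v p → sub' v (∪-introʳ {A v} p)) , inC }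
          where
          D = exchange (F c g j) g f
          same : ∀ W → A ⊑ W → edges D W ≡ edges (F c g j) W
          same W A⊑W = +-cancelʳ-≡ 1 _ _ (subst₂ (λ x y → edges D W + ⟦ x ⟧ ≡ edges (F c g j) W + ⟦ y ⟧)
            (within-mono A⊑W f fA) (within-mono A⊑W g (proj₂ (proj₁ mt)))
            (size-exchange (F c g j) (within W) g f (F-hole c g j) ff))
          tD : Tight 1 D B
          tD = tight-cong (λ i → sym (F-same c g j (hole r) f i)) (λ _ → refl) t
          tA : Tight 1 D A
          tA = mkTight (inhabited (proj₁ (proj₁ mt)))
            (subst (λ x → 1 * size A ≤ x + 1) (sym (same A λ _ p → p)) (saturated (proj₁ (proj₁ mt))))
          joined : Tight 1 (F c g j) (A ∪ B)
          joined = mkTight (w , ∪-introˡ (proj₁ (∧-true {A w} wAB)))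
            (subst (λ x → 1 * size (A ∪ B) ≤ x + 1) (same (A ∪ B) λ _ p → ∪-introˡ p)
              (saturated (tight-∪ w (sparse-exchange g f (classes r j) (F-hole c g j) mt ff fA) tA tD
                (proj₁ (∧-true {A w} wAB)) (proj₂ (∧-true {A w} wAB)))))

        src-at : ∀ g → at (src g) g ≡ true
        src-at g = ∪-introˡ (==-refl (src g))

        tgt-at : ∀ g → at (tgt g) g ≡ true
        tgt-at g = ∪-introʳ {src g == tgt g} (==-refl (tgt g))

        at-within : ∀ {A g v} → at v g ≡ true → within A g ≡ true → A v ≡ true
        at-within {A} {g} {v} p q with ∪-elim {src g == v} p
        ... | inj₁ r = subst (λ x → A x ≡ true) (==-sound r) (within-src A g q)
        ... | inj₂ r = subst (λ x → A x ≡ true) (==-sound r) (within-tgt A g q)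

        module _ (j : Fin m) (K : VSet) (tK : Tight 1 (F c₀ g₀ j) K) (K⊑C : K ⊑ C) (Kg₀ : K (src g₀) ≡ true)
                 (maximal : ∀ B → Tight 1 (F c₀ g₀ j) B × B ⊑ C × B (src g₀) ≡ true → size (∁ K) ≤ size (∁ B)) where

          absorb : ∀ {B} v → Tight 1 (F c₀ g₀ j) B → B ⊑ C → B v ≡ true → K v ≡ true → B ⊑ K
          absorb {B} v tB B⊑C bv kv w bw = not-injective (not-true λ kw → false≢true (trans
              (sym (cong not (∪-introʳ {K w} bw)))
              (⊑-antisym-size {A = ∁ (K ∪ B)} {∁ K} complement
                  (maximal (K ∪ B) (tight-∪ v (sp₀ j) tK tB kv bv , ∪-⊑ K⊑C B⊑C , ∪-introˡ Kg₀)) w kw)))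
            where
            complement : ∁ (K ∪ B) ⊑ ∁ K
            complement x p with K x
            ... | false = refl

          -- The circuit closed by the hole in class `j` leads back to a tight set of the initial
          -- class that meets `K`; by maximality of `K` it lies inside `K`.
          touch : ∀ {c g} → Reachable c g → ∀ v → at v g ≡ true → K v ≡ true → within K g ≡ true
          touch {c} {g} r v vg kv = decidable-stable (_ Bool.≟ _) λ k → circuit r j λ { (A , mt) →
            case backtrack r j A (proj₁ (proj₁ mt)) (circuit-⊑ r j mt) of λ { (B , tB , A⊑B , B⊑C) →
            k (within-mono (absorb v tB B⊑C (A⊑B v (at-within {A} {g} vg (proj₂ (proj₁ mt)))) kv) g
                (within-mono A⊑B g (proj₂ (proj₁ mt)))) } }

          -- Induction along the moves. If the span `A` of the circuit left `K`, sparsity of `A ∩ K`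
          -- and of `A` minus `K` would force an edge of the class between them; as the next hole it
          -- would touch `K` without lying inside it.
          holes-within : ∀ {c g} → Reachable c g → within K g ≡ true
          holes-within initial = touch initial (src g₀) (src-at g₀) Kg₀
          holes-within (move {c} {g} r i A mt f ff fA) = within-mono A⊑K f fA
            where
            gA = proj₂ (proj₁ mt)
            D = F c g i
            A⊑K : A ⊑ K
            A⊑K v av = decidable-stable (_ Bool.≟ _) λ kv → crossing (not-true kv)
              where
              crossing : K v ≡ false → ⊥
              crossing kv = contra (size-gap {A = D ∩ within A} {B = (D ∩ within (A ∩ K)) ∪
                  (D ∩ within (A ∩ ∁ K))} fewer)
                where
                b₁ = bound (classes r i) (A ∩ K) (src g) (true-∧ (within-src A g gA) (within-src K g (holes-within r)))
                b₂ = bound (classes r i) (A ∩ ∁ K) v (true-∧ av (cong not kv))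
                sizes : size (A ∩ K) + size (A ∩ ∁ K) ≡ size A
                sizes = trans (sym (∑-distrib-+ (λ w → ⟦ (A ∩ K) w ⟧) (λ w → ⟦ (A ∩ ∁ K) w ⟧)))
                  (sum-cong λ w → ≡ᵇ⇒≡ _ _ (truth-table 2 (λ a k → (⟦ a ∧ k ⟧ + ⟦ a ∧ not k ⟧) ≡ᵇ ⟦ a ⟧) tt (A w)
                      (K w)))
                fewer : size ((D ∩ within (A ∩ K)) ∪ (D ∩ within (A ∩ ∁ K))) < size (D ∩ within A)
                fewer = s≤s⁻¹ (begin
                  suc (suc (size ((D ∩ within (A ∩ K)) ∪ (D ∩ within (A ∩ ∁ K)))))
                    ≤⟨ s≤s (s≤s (m+n≤o⇒m≤o _ (≤-reflexive
                        (sym (size-∪-∩ (D ∩ within (A ∩ K)) (D ∩ within (A ∩ ∁ K))))))) ⟩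
                  suc (suc (edges D (A ∩ K) + edges D (A ∩ ∁ K))) ≡⟨ r1 (edges D (A ∩ K)) _ ⟩
                  (edges D (A ∩ K) + 1) + (edges D (A ∩ ∁ K) + 1) ≤⟨ +-mono-≤ b₁ b₂ ⟩
                  1 * size (A ∩ K) + 1 * size (A ∩ ∁ K) ≡⟨ r2 (size (A ∩ K)) _ ⟩
                  1 * (size (A ∩ K) + size (A ∩ ∁ K)) ≡⟨ cong (1 *_) sizes ⟩
                  1 * size A ≤⟨ saturated (proj₁ (proj₁ mt)) ⟩
                  edges D A + 1 ≡⟨ +-comm _ 1 ⟩
                  suc (edges D A) ∎)
                  where
                  open ≤-Reasoning
                  r1 : ∀ a b → suc (suc (a + b)) ≡ (a + 1) + (b + 1)
                  r1 = solve-∀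
                  r2 : ∀ a b → 1 * a + 1 * b ≡ 1 * (a + b)
                  r2 = solve-∀
                contra : (Σ (Fin (e G)) λ h → (D ∩ within A) h ≡ true ×
                    ((D ∩ within (A ∩ K)) ∪ (D ∩ within (A ∩ ∁ K))) h ≡ false) → ⊥
                contra (h , p , q) with ∧-true {D h} p
                ... | dh , ah with true-or-false (K (src h)) | true-or-false (K (tgt h))
                ... | inj₁ ks | inj₁ kt = false≢true (trans (sym q) (∪-introˡ (true-∧ dh
                        (true-∧ (true-∧ (within-src A h ah) ks) (true-∧ (within-tgt A h ah) kt)))))
                ... | inj₂ ks | inj₂ kt = false≢true (trans (sym q) (∪-introʳ {(D ∩ within (A ∩ K)) h} (true-∧ dh
                        (true-∧ (true-∧ (within-src A h ah) (cong not ks))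
                            (true-∧ (within-tgt A h ah) (cong not kt))))))
                ... | inj₁ ks | inj₂ kt = false≢true (trans (sym kt)
                    (within-tgt K h (touch (move r i A mt h dh ah) (src h) (src-at h) ks)))
                ... | inj₂ ks | inj₁ kt = false≢true (trans (sym ks)
                    (within-src K h (touch (move r i A mt h dh ah) (tgt h) (tgt-at h) kt)))

          C⊑K : C ⊑ K
          C⊑K v cv with C-elim v cv
          ... | c , f , r , p = at-within {K} {f} p (holes-within r)

          spanned : 1 * size C ≤ edges (F c₀ g₀ j) C + 1
          spanned = saturated (tight-cong (λ _ → refl) (λ v → bool-ext (K⊑C v) (C⊑K v)) tK)

        all-spanned : ∀ j → 1 * size C ≤ edges (F c₀ g₀ j) C + 1
        all-spanned j = decidable-stable (_ ≤? _) λ k → circuit initial j λ { (A , mt) →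
          least (λ B → Tight 1 (F c₀ g₀ j) B × B ⊑ C × B (src g₀) ≡ true) (λ B → size (∁ B))
            (proj₁ (proj₁ mt) , circuit-⊑ initial j mt , within-src A g₀ (proj₂ (proj₁ mt)))
            λ { (K , (tK , KC , Kg) , mx) → k (spanned j K tK KC Kg mx) } }

        overfull : ⊥
        overfull = <-irrefl refl (begin-strict
          edges H C + m ≤⟨ bound spH C (src g₀) (C-intro (src g₀) initial (src-at g₀)) ⟩
          m * size C ≡⟨ sum-const m (size C) ⟨
          sum {m} (λ _ → size C) ≤⟨ sum-mono (λ j → subst (_≤ edges (F c₀ g₀ j) C + 1) (*-identityˡ (size C))
              (all-spanned j)) ⟩
          sum (λ j → edges (F c₀ g₀ j) C + 1) ≡⟨ ∑-distrib-+ (λ j → edges (F c₀ g₀ j) C) (λ _ → 1) ⟩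
          sum (λ j → edges (F c₀ g₀ j) C) + sum {m} (λ _ → 1) ≡⟨ cong₂ _+_
              (∑-comm (λ j i → ⟦ (F c₀ g₀ j ∩ within C) i ⟧)) (size-full m) ⟩
          sum (λ i → sum (λ j → ⟦ (F c₀ g₀ j ∩ within C) i ⟧)) + m ≡⟨ cong (_+ m)
              (sum-cong λ i → trans (sum-cong {m} λ j → point i j) (sum-delta (c₀ i) _)) ⟩
          sum (λ i → ⟦ (H i ∧ not (g₀ == i)) ∧ within C i ⟧) + m <⟨ +-monoˡ-< m (size-mono-<
              {A = (H ∩ ∁ ⟨ g₀ ⟩) ∩ within C} {B = H ∩ within C}
              (λ i p → true-∧ (proj₁ (∧-true {H i} (proj₁ (∧-true {H i ∧ not (g₀ == i)} p))))
                  (proj₂ (∧-true {H i ∧ not (g₀ == i)} p))) g₀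
              (trans (cong (λ b → (H g₀ ∧ not b) ∧ within C g₀) (==-refl g₀)) (cong (_∧ within C g₀) (∧-zeroʳ (H g₀))))
              (true-∧ Hg₀ (true-∧ (C-intro (src g₀) initial (src-at g₀)) (C-intro (tgt g₀) initial (tgt-at g₀))))) ⟩
          edges H C + m ∎)
          where
          open ≤-Reasoning
          point : ∀ i j → ⟦ (F c₀ g₀ j ∩ within C) i ⟧ ≡ ⟦ c₀ i == j ⟧ * ⟦ (H i ∧ not (g₀ == i)) ∧ within C i ⟧
          point i j = ≡ᵇ⇒≡ _ _ (truth-table 3 (λ x y z → ⟦ (x ∧ y) ∧ z ⟧ ≡ᵇ (⟦ y ⟧ * ⟦ x ∧ z ⟧)) tt
              (H i ∧ not (g₀ == i)) (c₀ i == j) (within C i))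

      augment-⊥ : ⊥
      augment-⊥ = decide-all (n G) HoleEnd overfull

  -- Induction on the number of edges: all edges but one are coloured, and the remaining one is the
  -- hole of an augmentation.
  forestColouring : ∀ {m H} → .{{NonZero m}} → Sparse m H → ¬ ¬ ForestColouring m H
  forestColouring {m} {H} sp = go (suc (size H)) H sp ≤-refl
    where
    -- Even if `H` is empty, every edge of `G` must carry some colour.
    white : ∀ m → .{{NonZero m}} → Fin m
    white (suc m) = zero
    go : ∀ b H → Sparse m H → size H < b → ¬ ¬ ForestColouring m H
    go (suc b) H sp (s≤s le) k with any? (λ i → H i Bool.≟ true)
    ... | no none = k ((λ _ → white m) , λ j → mkSparse λ A v av →
            subst (λ x → x + 1 ≤ 1 * size A) (sym (sum-zero {f = λ i → ⟦
                (colourClass H (λ _ → white m) j ∩ within A) i ⟧}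
              λ i → cong (λ b → ⟦ (b ∧ _) ∧ _ ⟧) (not-true λ p → none (i , p))))
              (subst (1 ≤_) (sym (*-identityˡ _)) (size-pos A v av)))
    ... | yes (g , Hg) = go b (H ∩ ∁ ⟨ g ⟩) (sparse-⊑ (λ i p → proj₁ (∧-true {H i} p)) sp)
            (<-≤-trans (size-mono-< {A = H ∩ ∁ ⟨ g ⟩} {H} (λ i p → proj₁ (∧-true {H i} p)) g
              (trans (cong (λ b → H g ∧ not b) (==-refl g)) (∧-zeroʳ (H g))) Hg) le)
            λ { (c , forests) → Augment.augment-⊥ m H sp c g Hg forests k }

-- Spanning trees and cuts

-- Searching all edge sets, and all tuples of them, decides the final existence claim and thereby
-- removes the double negations.
Searchable : Set → Set₁
Searchable A = ∀ {P : A → Set} → (∀ a → Dec (P a)) → Dec (Σ A P)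

bool-searchable : Searchable Bool
bool-searchable P? with P? true | P? false
... | yes p | _ = yes (true , p)
... | no _ | yes p = yes (false , p)
... | no p | no q = no λ { (true , r) → p r ; (false , r) → q r }

vec-searchable : ∀ {A k} → Searchable A → Searchable (Vec A k)
vec-searchable {k = zero} s P? with P? []
... | yes p = yes ([] , p)
... | no p = no λ { ([] , q) → p q }
vec-searchable {k = suc k} s P? with s (λ a → vec-searchable {k = k} s (λ as → P? (a ∷ as)))
... | yes (a , as , p) = yes (a ∷ as , p)
... | no p = no λ { (a ∷ as , q) → p (a , as , q) }

subset-searchable : ∀ {k} → Searchable (Subset k)
subset-searchable = vec-searchable bool-searchable

∈⇒lookup : ∀ {k} {S : Subset k} {i} → i ∈ S → lookup S i ≡ true
∈⇒lookup = []=⇒lookup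

lookup⇒∈ : ∀ {k} {S : Subset k} {i} → lookup S i ≡ true → i ∈ S
lookup⇒∈ {S = S} {i} = lookup⇒[]= i S

∣∣-size : ∀ {k} (S : Subset k) → ∣ S ∣ ≡ size (lookup S)
∣∣-size [] = refl
∣∣-size (true ∷ S) = cong suc (∣∣-size S)
∣∣-size (false ∷ S) = ∣∣-size S

lookup-─ : ∀ {k} (S R : Subset k) i → lookup (S ─ R) i ≡ lookup S i ∧ not (lookup R i)
lookup-─ (true ∷ S) (true ∷ R) zero = refl
lookup-─ (true ∷ S) (false ∷ R) zero = refl
lookup-─ (false ∷ S) (true ∷ R) zero = refl
lookup-─ (false ∷ S) (false ∷ R) zero = refl
lookup-─ (x ∷ S) (true ∷ R) (suc i) = lookup-─ S R i
lookup-─ (x ∷ S) (false ∷ R) (suc i) = lookup-─ S R i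

lookup-⁅⁆ : ∀ {k} (x i : Fin k) → lookup ⁅ x ⁆ i ≡ (x == i)
lookup-⁅⁆ zero zero = refl
lookup-⁅⁆ zero (suc i) = lookup-replicate i false
lookup-⁅⁆ (suc x) zero = refl
lookup-⁅⁆ (suc x) (suc i) = trans (lookup-⁅⁆ x i) (sym (suc-== x i))

xor-false : ∀ {x y} → x xor y ≡ false → x ≡ y
xor-false {true} {true} _ = refl
xor-false {false} {false} _ = refl

xor-true : ∀ {x y} → x xor y ≡ true → (x ≡ true × y ≡ false) ⊎ (x ≡ false × y ≡ true)
xor-true {true} {false} _ = inj₁ (refl , refl)
xor-true {false} {true} _ = inj₂ (refl , refl)

≢⇒xor : ∀ {x y} → x ≡ true → y ≡ false → x xor y ≡ true
≢⇒xor refl refl = refl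

sum-unique : ∀ {k} (f : Fin k → Bool) → (∀ i j → f i ≡ true → f j ≡ true → i ≡ j) → size f ≤ 1
sum-unique f u with any? (λ i → f i Bool.≟ true)
... | no none = ≤-trans (≤-reflexive (sum-zero λ i → cong ⟦_⟧ (not-true λ p → none (i , p)))) z≤n
... | yes (i , p) = subst (size f ≤_) (size-⟨⟩ i) (size-mono λ j q → ==-complete (u i j p q))

module Connectivity (G : Graph) where

  open Sparsity G

  boundary : VSet → ESet
  boundary A i = A (src i) xor A (tgt i)

  reach-crosses : ∀ {S x y} A → Reach G S x y → A x ≡ true → A y ≡ false →
                  Σ (Fin (e G)) λ i → i ∈ S × boundary A i ≡ true
  reach-crosses A here p q = ⊥-elim (false≢true (trans (sym q) p))
  reach-crosses A (step {y} i iS r w inc) p q with true-or-false (A y)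
  ... | inj₂ ay = reach-crosses A r p ay
  ... | inj₁ ay with inc
  ... | inj₁ (refl , refl) = i , iS , ≢⇒xor ay q
  ... | inj₂ (refl , refl) = i , iS , trans (cong₂ _xor_ q ay) refl

  -- Ends of edges that leave the set are added until no edge leaves. By the invariant
  -- `n G < size B + fuel`, the fuel could run out only for a set larger than the graph.
  component : ∀ S x → Σ VSet λ B → B x ≡ true × (∀ v → B v ≡ true → Reach G S x v) ×
              (∀ i → i ∈ S → B (src i) ≡ B (tgt i))
  component S x = grow (suc (n G)) ⟨ x ⟩ (m≤n+m (suc (n G)) _) (==-refl x)
                    (λ v p → subst (Reach G S x) (==-sound p) here)
    where
    grow : ∀ fuel B → n G < size B + fuel → B x ≡ true → (∀ v → B v ≡ true → Reach G S x v) →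
           Σ VSet λ B → B x ≡ true × (∀ v → B v ≡ true → Reach G S x v) × (∀ i → i ∈ S → B (src i) ≡ B (tgt i))
    extend : ∀ fuel B v → n G < size B + suc fuel → B v ≡ false → Reach G S x v → B x ≡ true →
             (∀ v → B v ≡ true → Reach G S x v) →
             Σ VSet λ B → B x ≡ true × (∀ v → B v ≡ true → Reach G S x v) × (∀ i → i ∈ S → B (src i) ≡ B (tgt i))
    grow zero B lt bx rs = ⊥-elim (<⇒≱ lt (≤-trans (≤-reflexive (+-identityʳ _))
      (subst (size B ≤_) (size-full (n G)) (size-mono {A = B} λ _ _ → refl))))
    grow (suc fuel) B lt bx rs with any? (λ i → (lookup S i ∧ boundary B i) Bool.≟ true)
    ... | no none = B , bx , rs , λ i iS → xor-false (not-true λ p → none (i , true-∧ (∈⇒lookup iS) p))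
    ... | yes (i , p) with xor-true {B (src i)} (proj₂ (∧-true {lookup S i} p))
    ... | inj₁ (bs , bt) = extend fuel B (tgt i) lt bt
            (step i (lookup⇒∈ (proj₁ (∧-true p))) (rs (src i) bs) (tgt i) (inj₁ (refl , refl))) bx rs
    ... | inj₂ (bs , bt) = extend fuel B (src i) lt bs
            (step i (lookup⇒∈ (proj₁ (∧-true p))) (rs (tgt i) bt) (src i) (inj₂ (refl , refl))) bx rs
    extend fuel B v lt bv r bx rs = grow fuel (B ∪ ⟨ v ⟩)
      (<-≤-trans lt (≤-trans (≤-reflexive (+-suc (size B) fuel))
        (+-monoˡ-≤ fuel (size-mono-< {A = B} {B ∪ ⟨ v ⟩} (λ _ → ∪-introˡ) v bv (∪-introʳ {B v} (==-refl v))))))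
      (∪-introˡ bx) λ w p → case ∪-elim {B w} p of λ where
        (inj₁ q) → rs w q
        (inj₂ q) → subst (Reach G S x) (==-sound q) r

  reach? : ∀ S x y → Dec (Reach G S x y)
  reach? S x y with component S x
  ... | B , bx , rs , closed with true-or-false (B y)
  ... | inj₁ by = yes (rs y by)
  ... | inj₂ by = no λ r → case reach-crosses B r bx by of λ { (i , iS , p) →
          false≢true (trans (sym (xor-same (B (tgt i)))) (subst (λ b → b xor B (tgt i) ≡ true) (closed i iS) p)) }

  spanningTree? : ∀ T → Dec (SpanningTree G T)
  spanningTree? T = all? (λ x → all? (reach? T x)) ×-dec
    all? (λ i → (i ∈? T) →-dec ¬? (reach? (T ─ ⁅ i ⁆) (src i) (tgt i)))

  CutConnected : ESet → Set
  CutConnected H = ∀ A a b → A a ≡ true → A b ≡ false → Σ (Fin (e G)) λ i → H i ≡ true × boundary A i ≡ true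

  connected⇒cut : ∀ {S} → Connected G S → CutConnected (lookup S)
  connected⇒cut c A a b p q with reach-crosses A (c a b) p q
  ... | i , iS , x = i , ∈⇒lookup iS , x

  cut⇒connected : ∀ {S} → CutConnected (lookup S) → Connected G S
  cut⇒connected {S} c x y with component S x
  ... | B , bx , rs , closed with true-or-false (B y)
  ... | inj₁ by = rs y by
  ... | inj₂ by with c B x y bx by
  ... | i , iS , p = ⊥-elim (false≢true (trans (sym (xor-same (B (tgt i))))
      (subst (λ b → b xor B (tgt i) ≡ true) (closed i (lookup⇒∈ iS)) p)))

  -- A partition is encoded by an idempotent map to representatives, so that the fixed points count
  -- its parts.
  fixed : (Fin (n G) → Fin (n G)) → VSet
  fixed κ v = κ v == v

  crossing : (Fin (n G) → Fin (n G)) → ESet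
  crossing κ i = not (κ (src i) == κ (tgt i))

  crossing-intro : ∀ {κ} (R : VSet) {i} → boundary (λ v → R (κ v)) i ≡ true → crossing κ i ≡ true
  crossing-intro {κ} R {i} p = cong not (≢⇒== λ q → false≢true (trans (sym (xor-same (R (κ (tgt i)))))
    (subst (λ r → R r xor R (κ (tgt i)) ≡ true) q p)))

  -- Contracting the parts leaves a connected graph. Among the sets of representatives that contain
  -- `κ v₀` and span enough edges a largest one is taken; if it missed a representative, an edge
  -- leaving it would enlarge it.
  parts-≤-crossing : ∀ {H} κ → (∀ v → κ (κ v) ≡ κ v) → CutConnected H → Fin (n G) →
                     size (fixed κ) ≤ size (H ∩ crossing κ) + 1
  parts-≤-crossing {H} κ idem conn v₀ = decidable-stable (_ ≤? _) λ k →
    least Spanned (λ R → size (∁ R)) initial λ { ((R) , (R⊑ , Rr , cnt) , mx) → k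
        (≤-trans (size-mono (maximal R R⊑ Rr cnt mx))
      (≤-trans cnt (+-monoˡ-≤ 1 (size-mono {A = spannedEdges R} λ i p → proj₁ (∧-true {(H ∩ crossing κ) i} p))))) }
    where
    spannedEdges : VSet → ESet
    spannedEdges R = (H ∩ crossing κ) ∩ (λ i → R (κ (src i)) ∧ R (κ (tgt i)))
    Spanned : VSet → Set
    Spanned R = R ⊑ fixed κ × R (κ v₀) ≡ true × size R ≤ size (spannedEdges R) + 1
    initial : Spanned ⟨ κ v₀ ⟩
    initial = (λ v p → subst (λ w → fixed κ w ≡ true) (==-sound p) (==-complete (idem v₀))) , ==-refl (κ v₀) ,
      ≤-trans (≤-reflexive (size-⟨⟩ (κ v₀))) (m≤n+m 1 _)
    module _ (R : VSet) (R⊑ : R ⊑ fixed κ) (Rr : R (κ v₀) ≡ true) (cnt : size R ≤ size (spannedEdges R) + 1)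
             (mx : ∀ R' → Spanned R' → size (∁ R) ≤ size (∁ R')) where
      blocked : ∀ i w → H i ≡ true → crossing κ i ≡ true → R w ≡ false → κ w ≡ w →
                (R ∪ ⟨ w ⟩) (κ (src i)) ∧ (R ∪ ⟨ w ⟩) (κ (tgt i)) ≡ true →
                R (κ (src i)) ∧ R (κ (tgt i)) ≡ false → ⊥
      blocked i w Hi ci Rw κw new old = <⇒≱ (size-mono-< {A = ∁ R'} {∁ R} shrink w
          (cong not (∪-introʳ {R w} (==-refl w))) (cong not Rw))
          (mx R' (∪-⊑ R⊑ (λ v p → subst (λ w → fixed κ w ≡ true) (==-sound p) (==-complete κw)) , ∪-introˡ Rr , grown))
        where
        R' = R ∪ ⟨ w ⟩
        shrink : ∁ R' ⊑ ∁ R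
        shrink x p with R x
        ... | false = refl
        sizeR' : size R' ≤ size R + 1
        sizeR' = ≤-trans (m+n≤o⇒m≤o _ (≤-reflexive (sym (size-∪-∩ R ⟨ w ⟩))))
            (≤-reflexive (cong (λ x → size R + x) (size-⟨⟩ w)))
        grown : size R' ≤ size (spannedEdges R') + 1
        grown = ≤-trans sizeR' (+-monoˡ-≤ 1 (≤-trans cnt (≤-trans (≤-reflexive (+-comm _ 1))
          (size-mono-< {A = spannedEdges R} {spannedEdges R'}
            (λ j p → true-∧ (proj₁ (∧-true {(H ∩ crossing κ) j} p))
                (case ∧-true {R (κ (src j))} (proj₂ (∧-true {(H ∩ crossing κ) j} p)) of
              λ { (a , b) → true-∧ (∪-introˡ a) (∪-introˡ b) }))
            i (trans (cong ((H ∩ crossing κ) i ∧_) old) (∧-zeroʳ _)) (true-∧ (true-∧ Hi ci) new)))))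
      maximal : fixed κ ⊑ R
      maximal v fv with true-or-false (R v)
      ... | inj₁ p = p
      ... | inj₂ q with conn (λ w → R (κ w)) v₀ v Rr (trans (cong R (==-sound fv)) q)
      ... | i , Hi , x with xor-true {R (κ (src i))} x
      ... | inj₁ (a , b) = ⊥-elim (blocked i (κ (tgt i)) Hi (crossing-intro {κ} R {i} x) b (idem _)
              (true-∧ (∪-introˡ a) (∪-introʳ {R (κ (tgt i))} (==-refl (κ (tgt i)))))
                  (trans (cong (_∧ R (κ (tgt i))) a) b))
      ... | inj₂ (a , b) = ⊥-elim (blocked i (κ (src i)) Hi (crossing-intro {κ} R {i} x) a (idem _)
              (true-∧ (∪-introʳ {R (κ (src i))} (==-refl (κ (src i)))) (∪-introˡ b)) (cong (_∧ R (κ (tgt i))) a))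

  -- Deleting an edge of a cycle keeps the graph connected, but then fewer than n - 1 edges would
  -- connect n vertices, against `parts-≤-crossing` for the partition into singletons.
  cut⇒acyclic : ∀ {S} → CutConnected (lookup S) → size (lookup S) + 1 ≤ n G → Acyclic G S
  cut⇒acyclic {S} conn le i iS r = <-irrefl refl (begin-strict
      n G ≡⟨ trans (sym (size-full (n G))) (size-cong {A = full} λ v → sym (==-refl v)) ⟩
      size (fixed λ v → v) ≤⟨ parts-≤-crossing (λ v → v) (λ _ → refl) conn' (src i) ⟩
      size (lookup S' ∩ crossing (λ v → v)) + 1 ≤⟨ +-monoˡ-≤ 1
          (size-mono {A = lookup S' ∩ crossing (λ v → v)} λ j p → proj₁ (∧-true {lookup S' j} p)) ⟩
      size (lookup S') + 1 ≡⟨ +-comm _ 1 ⟩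
      suc (size (lookup S')) ≤⟨ size-mono-< {A = lookup S'}
          (λ j p → proj₁ (∧-true {lookup S j} (trans (sym (lookup-─ S ⁅ i ⁆ j)) p))) i
        (trans (lookup-─ S ⁅ i ⁆ i) (trans (cong (λ b → lookup S i ∧ not b) (trans (lookup-⁅⁆ i i) (==-refl i)))
            (∧-zeroʳ _))) (∈⇒lookup iS) ⟩
      size (lookup S) <⟨ ≤-reflexive (+-comm 1 _) ⟩
      size (lookup S) + 1 ≤⟨ le ⟩
      n G ∎)
    where
    open ≤-Reasoning
    S' = S ─ ⁅ i ⁆
    conn' : CutConnected (lookup S')
    conn' A a b p q with conn A a b p q
    ... | j , jS , x with i ≟ j
    ... | no ne = j , trans (lookup-─ S ⁅ i ⁆ j) (true-∧ jS (cong not (trans (lookup-⁅⁆ i j) (≢⇒== ne)))) , x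
    ... | yes refl with xor-true {A (src i)} x
    ... | inj₁ (s , t) = case reach-crosses A r s t of λ { (h , hS , y) → h , ∈⇒lookup hS , y }
    ... | inj₂ (s , t) = case reach-crosses (∁ A) r (cong not s)
        (cong not t) of λ { (h , hS , y) → h , ∈⇒lookup hS , xor-not {A (src h)} y }
      where
      xor-not : ∀ {x y} → not x xor not y ≡ true → x xor y ≡ true
      xor-not {true} {false} _ = refl
      xor-not {false} {true} _ = refl

  edges-full : ∀ H → edges H full ≡ size H
  edges-full H = size-cong λ i → ∧-identityʳ (H i)

  sparse-total : ∀ {m H} → Sparse m H → Fin (n G) → size H + m ≤ m * n G
  sparse-total {m} {H} sp v = subst₂ (λ x y → x + m ≤ m * y) (edges-full H) (size-full (n G)) (bound sp full v refl)

  -- Two sets without crossing edges between them carry at most n - 2 edges.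
  sparse⇒cut : ∀ {H} → Sparse 1 H → n G ≤ size H + 1 → CutConnected H
  sparse⇒cut {H} sp le A a b p q with any? (λ i → (H i ∧ boundary A i) Bool.≟ true)
  ... | yes (i , r) = i , ∧-true r
  ... | no none = ⊥-elim (<-irrefl refl (begin-strict
      n G ≤⟨ le ⟩
      size H + 1 ≤⟨ +-monoˡ-≤ 1 (≤-trans (size-mono {A = H} {(H ∩ within A) ∪ (H ∩ within (∁ A))} split)
        (m+n≤o⇒m≤o _ (≤-reflexive (sym (size-∪-∩ (H ∩ within A) (H ∩ within (∁ A))))))) ⟩
      edges H A + edges H (∁ A) + 1 <⟨ ≤-reflexive (r1 (edges H A) _) ⟩
      (edges H A + 1) + (edges H (∁ A) + 1) ≤⟨ +-mono-≤ (bound sp A a p) (bound sp (∁ A) b (cong not q)) ⟩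
      1 * size A + 1 * size (∁ A) ≡⟨ cong₂ _+_ (*-identityˡ (size A)) (*-identityˡ (size (∁ A))) ⟩
      size A + size (∁ A) ≡⟨ size-∁ A ⟩
      n G ∎))
    where
    open ≤-Reasoning
    r1 : ∀ a b → suc (a + b + 1) ≡ (a + 1) + (b + 1)
    r1 = solve-∀
    split : H ⊑ ((H ∩ within A) ∪ (H ∩ within (∁ A)))
    split i h with xor-false {A (src i)} (not-true λ x → none (i , true-∧ h x)) | true-or-false (A (src i))
    ... | eq | inj₁ s = ∪-introˡ (true-∧ h (true-∧ s (trans (sym eq) s)))
    ... | eq | inj₂ s = ∪-introʳ {(H ∩ within A) i} (true-∧ h (true-∧ (cong not s) (cong not (trans (sym eq) s))))

  open Arboricity G

  module _ {m : ℕ} (S : Factor G) (v₀ : Fin (n G)) (total : m * n G ≤ size (lookup S) + m)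
           (c : Fin (e G) → Fin m) (forests : ∀ j → Sparse 1 (colourClass (lookup S) c j)) where

    private
      class = colourClass (lookup S) c

    classes-total : sum (λ j → size (class j)) ≡ size (lookup S)
    classes-total = trans (∑-comm (λ j i → ⟦ class j i ⟧))
        (sum-cong λ i → trans (sum-cong {m} (λ j → point i j)) (sum-delta (c i) _))
      where
      point : ∀ i j → ⟦ class j i ⟧ ≡ ⟦ c i == j ⟧ * ⟦ lookup S i ⟧
      point i j = ≡ᵇ⇒≡ _ _ (truth-table 2 (λ x y → ⟦ x ∧ y ⟧ ≡ᵇ (⟦ y ⟧ * ⟦ x ⟧)) tt (lookup S i) (c i == j))

    class-≤ : ∀ j → size (class j) + 1 ≤ n G
    class-≤ j = subst (size (class j) + 1 ≤_) (*-identityˡ (n G)) (sparse-total (forests j) v₀)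

    -- The `m` classes have at most n - 1 edges each and m(n - 1) in total, so none falls short.
    class-≥ : ∀ j → n G ≤ size (class j) + 1
    class-≥ j = ≮⇒≥ λ lt → <-irrefl refl (begin-strict
      size (lookup S) + m ≡⟨ cong₂ _+_ (sym classes-total) (sym (size-full m)) ⟩
      sum (λ j → size (class j)) + sum {m} (λ _ → 1) ≡⟨ ∑-distrib-+ (λ j → size (class j)) (λ _ → 1) ⟨
      sum (λ j → size (class j) + 1) <⟨ sum-mono-< class-≤ j lt ⟩
      sum {m} (λ _ → n G) ≡⟨ sum-const m (n G) ⟩
      m * n G ≤⟨ total ⟩
      size (lookup S) + m ∎)
      where open ≤-Reasoning

    coloured-treeConnected : TreeConnected G m S
    coloured-treeConnected = T , (λ j {i} p → lookup⇒∈ (proj₁ (∧-true {lookup S i} (T⇒class j i p)))) ,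
        (λ j → cut⇒connected (conn j) , cut⇒acyclic (conn j)
            (subst (λ x → x + 1 ≤ n G) (sym (size-cong (lookup∘tabulate (class j)))) (class-≤ j))) ,
        λ j j' i p q → trans (sym (colour j i p)) (colour j' i q)
      where
      T : Fin m → Factor G
      T j = tabulate (class j)
      T⇒class : ∀ j i → i ∈ T j → class j i ≡ true
      T⇒class j i p = trans (sym (lookup∘tabulate (class j) i)) (∈⇒lookup p)
      colour : ∀ j i → i ∈ T j → c i ≡ j
      colour j i p = ==-sound (proj₂ (∧-true {lookup S i} (T⇒class j i p)))
      conn : ∀ j → CutConnected (lookup (T j))
      conn j A a b p q with sparse⇒cut (forests j) (class-≥ j) A a b p q
      ... | i , h , x = i , trans (lookup∘tabulate (class j) i) h , x

  sparse⇒treeConnected : ∀ {m} S → .{{NonZero m}} → Fin (n G) → Sparse m (lookup S) → m * n G ≤ size (lookup S) + m →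
                         ¬ ¬ TreeConnected G m S
  sparse⇒treeConnected S v₀ sp total k = forestColouring sp λ { (c , forests) →
    k (coloured-treeConnected S v₀ total c forests) }

  -- A family of trees is a function, known only pointwise; vectors are searched in its place and
  -- carried over by `lookup∘tabulate`.
  treeConnected? : ∀ m S → Dec (TreeConnected G m S)
  treeConnected? m S with vec-searchable {k = m} subset-searchable (λ Ts →
      all? (λ j → lookup Ts j ⊆? S) ×-dec all? (λ j → spanningTree? (lookup Ts j)) ×-dec
      all? (λ j → all? λ j' → all? λ i → (i ∈? lookup Ts j) →-dec ((i ∈? lookup Ts j') →-dec (j ≟ j'))))
  ... | yes (Ts , sub , trees , disjoint) = yes (lookup Ts , sub , trees , disjoint)
  ... | no none = no λ { (T , sub , trees , disjoint) → none (tabulate T ,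
      (λ j → subst (_⊆ S) (sym (lookup∘tabulate T j)) (sub j)) ,
      (λ j → subst (SpanningTree G) (sym (lookup∘tabulate T j)) (trees j)) ,
      (λ j j' i p q → disjoint j j' i (subst (i ∈_) (lookup∘tabulate T j) p) (subst (i ∈_) (lookup∘tabulate T j') q))) }

  -- Each tree connects the contracted parts, and disjointness lets the crossing edges of the `k`
  -- trees be added up.
  treeConnected-crossing : ∀ {k} → GTreeConnected G k → ∀ κ → (∀ v → κ (κ v) ≡ κ v) → Fin (n G) →
                           k * size (fixed κ) ≤ size (crossing κ) + k
  treeConnected-crossing {k} (T , _ , trees , disjoint) κ idem v₀ = begin
      k * size (fixed κ) ≡⟨ sum-const k _ ⟨
      sum {k} (λ _ → size (fixed κ)) ≤⟨ sum-mono (λ j → parts-≤-crossing κ idem (connected⇒cut (proj₁ (trees j))) v₀) ⟩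
      sum (λ j → size (lookup (T j) ∩ crossing κ) + 1) ≡⟨ ∑-distrib-+ (λ j → size (lookup (T j) ∩ crossing κ))
          (λ _ → 1) ⟩
      sum (λ j → size (lookup (T j) ∩ crossing κ)) + sum {k} (λ _ → 1) ≡⟨ cong₂ _+_
          (∑-comm (λ j i → ⟦ (lookup (T j) ∩ crossing κ) i ⟧)) (size-full k) ⟩
      sum (λ i → sum (λ j → ⟦ (lookup (T j) ∩ crossing κ) i ⟧)) + k ≤⟨ +-monoˡ-≤ k (sum-mono once) ⟩
      size (crossing κ) + k ∎
    where
    open ≤-Reasoning
    once : ∀ i → sum (λ j → ⟦ (lookup (T j) ∩ crossing κ) i ⟧) ≤ ⟦ crossing κ i ⟧
    once i with crossing κ i
    ... | true = sum-unique (λ j → lookup (T j) i ∧ true) λ j j' p q →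
                   disjoint j j' i (lookup⇒∈ (proj₁ (∧-true p))) (lookup⇒∈ (proj₁ (∧-true q)))
    ... | false = ≤-reflexive (sum-zero λ j → cong ⟦_⟧ (∧-zeroʳ (lookup (T j) i)))

  -- Deleting `boundary A` itself would separate `a` from `b`.
  edgeConnected-boundary : ∀ {k} → EdgeConnected G k → ∀ A a b → A a ≡ true → A b ≡ false → k ≤ size (boundary A)
  edgeConnected-boundary {k} conn A a b p q = ≮⇒≥ λ lt →
    case reach-crosses A (conn F (subst (_< k) (sym sizeF) lt) a b) p q of λ { (i , iS , x) →
      false≢true (trans (sym (trans (lookup-─ ⊤ F i) (trans
          (cong (λ b → lookup ⊤ i ∧ not b) (trans (lookup∘tabulate (boundary A) i) x)) (∧-zeroʳ _))))
        (∈⇒lookup iS)) }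
    where
    F = tabulate (boundary A)
    sizeF : ∣ F ∣ ≡ size (boundary A)
    sizeF = trans (∣∣-size F) (size-cong (lookup∘tabulate (boundary A)))

  deg-degree : ∀ S v → deg G S v ≡ degree (lookup S) v
  deg-degree S v = trans (∣∣-size (S Subset.∩ incident G v)) (size-cong λ i →
    trans (lookup-zipWith _∧_ i S (incident G v)) (cong (lookup S i ∧_) (lookup∘tabulate (at v) i)))

-- Local search for the degree bounds

module Descent (G : Graph) (m : ℕ) (M : Fin (e G) → Bool) (h : Fin (n G) → ℕ)
               (degM : ∀ v → Sparsity.degree G M v ≤ m) where

  open Sparsity G
  open Connectivity G

  excess deficit potential : ESet → ℕ
  excess H = sum λ v → degree H v ∸ h v
  deficit H = m * n G ∸ (size H + m)
  potential H = excess H + deficit H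

  part : (Fin (n G) → Fin (n G)) → Fin (n G) → VSet
  part κ v w = κ w == κ v

  Admissible : ESet → Set
  Admissible H = Sparse m H × M ⊑ H

  module _ (H : ESet) where

    -- An edge at v may be added after an exchange confined to K.
    record Relievable (K : VSet) (v : Fin (n G)) : Set where
      field
        H' : ESet
        admissible : Admissible H'
        agree : AgreeOff K H' H
        count : edges H' K ≡ edges H K
        slack : degree H' v < h v
        fits : ∀ w → K w ≡ true → degree H' w ≤ h w

    open Relievable

    relievable-cong : ∀ {K K' v} → K ⊑ K' → K' ⊑ K → Relievable K v → Relievable K' v
    relievable-cong {K} {K'} sub sup r = record
      { H' = H' r ; admissible = admissible r
      ; agree = λ i p → agree r i (trans (cong₂ _∧_ (same _) (same _)) p)
      ; count = trans (sym (edges-cong {H' r} {A = K} (λ _ → refl) same))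
          (trans (count r) (edges-cong {H} {A = K} (λ _ → refl) same))
      ; slack = slack r ; fits = λ w p → fits r w (sup w p) }
      where
      same : ∀ w → K w ≡ K' w
      same w = bool-ext (sub w) (sup w)

    relievable-mono : ∀ {K W v} → K ⊑ W → (∀ w → W w ≡ true → degree H w ≤ h w) → Relievable K v → Relievable W v
    relievable-mono {K} {W} sub fit r = record
      { H' = H' r ; admissible = admissible r
      ; agree = λ i p → agree r i (not-true λ q → false≢true (trans (sym p) (within-mono sub i q)))
      ; count = edges-agreeOff (agree r) (count r) sub
      ; slack = slack r ; fits = fits' }
      where
      fits' : ∀ w → W w ≡ true → degree (H' r) w ≤ h w
      fits' w p with true-or-false (K w)
      ... | inj₁ q = fits r w q
      ... | inj₂ q = subst (_≤ h w) (sym (degree-agreeOff {K} w (agree r) q)) (fit w p)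

    record Stage : Set where
      field
        κ : Fin (n G) → Fin (n G)
        S : VSet
        idem : ∀ v → κ (κ v) ≡ κ v
        tight : ∀ v → Tight m H (part κ v)
        single : ∀ v w → S v ≡ true → κ w ≡ κ v → w ≡ v
        loaded : ∀ v → S v ≡ true → h v ≤ degree H v
        fits : ∀ v → S v ≡ false → degree H v ≤ h v
        relievable : ∀ v → S v ≡ false → Relievable (part κ v) v

    -- A vertex below its bound needs no exchange, so `H` relieves it; all others go to `S`. A
    -- singleton is tight because m(1 - 1) = 0.
    initialStage : Admissible H → Stage
    initialStage adm = record
      { κ = λ v → v ; S = λ v → h v ≤ᵇ degree H v ; idem = λ _ → refl
      ; tight = λ v → mkTight (v , ==-refl v) (≤-trans
          (≤-reflexive (trans (cong (m *_) (trans (size-cong {A = λ w → w == v} λ w → ==-sym w v) (size-⟨⟩ v)))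
          (*-identityʳ m))) (m≤n+m m _))
      ; single = λ _ _ _ p → p ; loaded = λ v p → ≤ᵇ⇒≤ _ _ (subst Bool.T (sym p) tt)
      ; fits = λ v p → <⇒≤ (light v p)
      ; relievable = λ v p → record { H' = H ; admissible = adm ; agree = λ _ _ → refl ; count = refl
          ; slack = light v p ; fits = λ w q → subst (λ x → degree H x ≤ h x) (sym (==-sound q)) (<⇒≤ (light v p)) } }
      where
      light : ∀ v → (h v ≤ᵇ degree H v) ≡ false → degree H v < h v
      light v p = ≰⇒> λ le → subst Bool.T p (≤⇒≤ᵇ le)

    Respects : VSet → VSet → Set
    Respects K W = K ⊑ W ⊎ Disjoint K W

    -- D relieves both ends of g at once; they lie in different parts, so the two modifications do not interfere.
    record Relieved (st : Stage) (g : Fin (e G)) : Set where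
      open Stage st using (κ; S)
      field
        D : ESet
        sparseD : Sparse m D
        M⊑D : M ⊑ D
        edgesD : ∀ {W} → Respects (part κ (src g)) W → Respects (part κ (tgt g)) W → edges D W ≡ edges H W
        D-off : ∀ i → within (part κ (src g)) i ≡ false → within (part κ (tgt g)) i ≡ false → D i ≡ H i
        Dg : D g ≡ false
        fitsD : ∀ w → S w ≡ false → degree D w ≤ h w
        loadedD : ∀ w → S w ≡ true → degree D w ≡ degree H w
        end-slack : ∀ w → at w g ≡ true → degree D w < h w

      sizeD : size D ≡ size H
      sizeD = trans (sym (edges-full D)) (trans (edgesD (inj₁ λ _ _ → refl) (inj₁ λ _ _ → refl)) (edges-full H))

    module Relieve (st : Stage) (g : Fin (e G)) (Hg : H g ≡ false) (κg : Stage.κ st (src g) ≢ Stage.κ st (tgt g))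
                   (Ss : Stage.S st (src g) ≡ false) (Stg : Stage.S st (tgt g) ≡ false) where

      open Stage st hiding (fits) renaming (relievable to relievableSt)
      open Stage st using () renaming (fits to fitsSt)

      K₁ K₂ : VSet
      K₁ = part κ (src g)
      K₂ = part κ (tgt g)

      r₁ : Relievable K₁ (src g)
      r₁ = relievableSt (src g) Ss
      r₂ : Relievable K₂ (tgt g)
      r₂ = relievableSt (tgt g) Stg

      H₁ H₂ D : ESet
      H₁ = H' r₁
      H₂ = H' r₂
      D = graft K₂ H₂ H₁

      K₁K₂ : Disjoint K₁ K₂
      K₁K₂ w p q = κg (trans (sym (==-sound {x = κ w} p)) (==-sound {x = κ w} q))

      off₁ : ∀ {w} → K₂ w ≡ true → K₁ w ≡ false
      off₁ {w} p = not-true λ q → K₁K₂ w q p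

      off₂ : ∀ {w} → K₁ w ≡ true → K₂ w ≡ false
      off₂ {w} p = not-true λ q → K₁K₂ w p q

      -- `K₂` is still tight in `H₁`, which differs from `H` only inside the disjoint part `K₁`, so
      -- the inside of `K₂` may be replaced.
      sparseD : Sparse m D
      sparseD = sparse-graft (proj₁ (admissible r₁)) (proj₁ (admissible r₂))
        (mkTight (inhabited (tight (tgt g))) (subst (λ x → m * size K₂ ≤ x + m)
            (sym (edges-agreeOff-disjoint (agree r₁) K₁K₂)) (saturated (tight (tgt g)))))

      M⊑D : M ⊑ D
      M⊑D i p with within K₂ i
      ... | true = proj₂ (admissible r₂) i p
      ... | false = proj₂ (admissible r₁) i p

      agreeD : AgreeOff K₂ D H₁
      agreeD i p rewrite p = refl

      D-inside : ∀ i → within K₂ i ≡ true → D i ≡ H₂ i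
      D-inside i p rewrite p = refl

      countD : edges D K₂ ≡ edges H₁ K₂
      countD = trans (size-cong point) (trans (count r₂) (sym (edges-agreeOff-disjoint (agree r₁) K₁K₂)))
        where
        point : ∀ i → (D ∩ within K₂) i ≡ (H₂ ∩ within K₂) i
        point i with true-or-false (within K₂ i)
        ... | inj₁ p rewrite D-inside i p = refl
        ... | inj₂ p rewrite p = trans (∧-zeroʳ _) (sym (∧-zeroʳ (H₂ i)))

      edgesD : ∀ {W} → Respects K₁ W → Respects K₂ W → edges D W ≡ edges H W
      edgesD {W} x y = trans (second y) (first x)
        where
        first : Respects K₁ W → edges H₁ W ≡ edges H W
        first (inj₁ sub) = edges-agreeOff (agree r₁) (count r₁) sub
        first (inj₂ dj) = edges-agreeOff-disjoint (agree r₁) dj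
        second : Respects K₂ W → edges D W ≡ edges H₁ W
        second (inj₁ sub) = edges-agreeOff agreeD countD sub
        second (inj₂ dj) = edges-agreeOff-disjoint agreeD dj

      D-off : ∀ i → within K₁ i ≡ false → within K₂ i ≡ false → D i ≡ H i
      D-off i p q = trans (agreeD i q) (agree r₁ i p)

      Dg : D g ≡ false
      Dg = trans (D-off g (not-true λ p → false≢true (trans (sym (off₁ (==-refl (κ (tgt g))))) (within-tgt K₁ g p)))
                          (not-true λ p → false≢true (trans (sym (off₂ (==-refl (κ (src g))))) (within-src K₂ g p)))) Hg

      degree₁ : ∀ w → K₁ w ≡ true → degree D w ≡ degree H₁ w
      degree₁ w p = degree-agreeOff {K₂} w agreeD (off₂ p)

      degree₂ : ∀ w → K₂ w ≡ true → degree D w ≡ degree H₂ w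
      degree₂ w p = degree-local w point
        where
        point : ∀ i → at w i ≡ true → D i ≡ H₂ i
        point i q with true-or-false (within K₂ i)
        ... | inj₁ x = D-inside i x
        ... | inj₂ x = trans (D-off i (at-outside {K₁} i (off₁ p) q) x) (sym (agree r₂ i x))

      degree₀ : ∀ w → K₁ w ≡ false → K₂ w ≡ false → degree D w ≡ degree H w
      degree₀ w p q = trans (degree-agreeOff {K₂} w agreeD q) (degree-agreeOff {K₁} w (agree r₁) p)

      fitsD : ∀ w → S w ≡ false → degree D w ≤ h w
      fitsD w p with true-or-false (K₁ w) | true-or-false (K₂ w)
      ... | inj₁ q | _ = subst (_≤ h w) (sym (degree₁ w q)) (fits r₁ w q)
      ... | inj₂ _ | inj₁ q = subst (_≤ h w) (sym (degree₂ w q)) (fits r₂ w q)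
      ... | inj₂ q | inj₂ q' = subst (_≤ h w) (sym (degree₀ w q q')) (fitsSt w p)

      loadedD : ∀ w → S w ≡ true → degree D w ≡ degree H w
      loadedD w p = degree₀ w
        (not-true λ q → false≢true (trans (sym Ss) (subst (λ x → S x ≡ true)
            (sym (single w (src g) p (sym (==-sound q)))) p)))
        (not-true λ q → false≢true (trans (sym Stg) (subst (λ x → S x ≡ true)
            (sym (single w (tgt g) p (sym (==-sound q)))) p)))

      end-slack : ∀ w → at w g ≡ true → degree D w < h w
      end-slack w p with ∪-elim {src g == w} p
      ... | inj₁ q = subst (λ w → degree D w < h w) (==-sound q)
          (subst (_< h (src g)) (sym (degree₁ (src g) (==-refl (κ (src g))))) (slack r₁))
      ... | inj₂ q = subst (λ w → degree D w < h w) (==-sound q)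
          (subst (_< h (tgt g)) (sym (degree₂ (tgt g) (==-refl (κ (tgt g))))) (slack r₂))

      relieved : Relieved st g
      relieved = record { D = D ; sparseD = sparseD ; M⊑D = M⊑D ; edgesD = edgesD ; D-off = D-off ; Dg = Dg
                        ; fitsD = fitsD ; loadedD = loadedD ; end-slack = end-slack }

    module Merge (least-potential : ∀ D → Admissible D → potential H ≤ potential D) (st : Stage)
                 (g : Fin (e G)) (κg : Stage.κ st (src g) ≢ Stage.κ st (tgt g))
                 (Ss : Stage.S st (src g) ≡ false) (Stg : Stage.S st (tgt g) ≡ false) (rel : Relieved st g) where

      open Stage st hiding (fits) renaming (relievable to relievableSt)
      open Stage st using () renaming (fits to fitsSt)
      open Relieved rel

      K₁ K₂ : VSet
      K₁ = part κ (src g)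
      K₂ = part κ (tgt g)

      S-off : ∀ w → S w ≡ true → at w g ≡ false
      S-off w p = not-true λ q → case ∪-elim {src g == w} q of λ where
        (inj₁ x) → false≢true (trans (sym Ss) (subst (λ x → S x ≡ true) (sym (==-sound x)) p))
        (inj₂ x) → false≢true (trans (sym Stg) (subst (λ x → S x ≡ true) (sym (==-sound x)) p))

      module _ (D' : ESet) (grows : ∀ w → degree D' w ≤ degree D w + ⟦ at w g ⟧) where

        fits' : ∀ w → S w ≡ false → degree D' w ≤ h w
        fits' w p with at w g in eq | grows w
        ... | true | le = ≤-trans le (≤-trans (≤-reflexive (+-comm _ 1)) (end-slack w eq))
        ... | false | le = ≤-trans le (≤-trans (≤-reflexive (+-identityʳ _)) (fitsD w p))

        loaded' : ∀ w → S w ≡ true → degree D' w ≤ degree H w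
        loaded' w p = ≤-trans (grows w) (≤-reflexive (trans (cong (λ b → degree D w + ⟦ b ⟧) (S-off w p))
            (trans (+-identityʳ _) (loadedD w p))))

        -- The unit that `g` may add at its ends is absorbed by `end-slack`, and no vertex of `S` is
        -- an end of `g`.
        excess-≤ : ∀ w → degree D' w ∸ h w ≤ degree H w ∸ h w
        excess-≤ w with true-or-false (S w)
        ... | inj₁ p = ∸-monoˡ-≤ (h w) (loaded' w p)
        ... | inj₂ p = ≤-trans (≤-reflexive (m≤n⇒m∸n≡0 (fits' w p))) z≤n

      -- Inserting `g` into the relieved set would raise no excess and lower the deficit by one,
      -- against the least potential.
      no-insertion : (∀ A → Tight m D A → within A g ≡ true → ⊥) → ⊥
      no-insertion free = <⇒≱ better (least-potential D' (sparseD' , λ i p → ∪-introˡ (M⊑D i p)))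
        where
        D' = D ∪ ⟨ g ⟩
        sparseD' : Sparse m D'
        sparseD' = sparse-insert g sparseD Dg free
        sizeD' : size D' ≡ suc (size H)
        sizeD' = trans (sym (edges-full D')) (trans (size-insert D (within full) g Dg)
            (trans (cong (_+ 1) (trans (edges-full D) sizeD)) (+-comm _ 1)))
        better : potential D' < potential H
        better = +-mono-≤-< (sum-mono (excess-≤ D' λ w → ≤-reflexive (size-insert D (at w) g Dg)))
          (∸-monoʳ-< (+-monoˡ-≤ m (≤-reflexive (sym sizeD'))) (sparse-total sparseD' (src g)))

      module _ (B : VSet) (mt : MinTight m D g B) where

        exchangeEdge : ∀ v → B v ≡ true → S v ≡ true →
                       Σ (Fin (e G)) λ f → D f ≡ true × within B f ≡ true × at v f ≡ true × M f ≡ false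
        exchangeEdge v Bv Sv = minTight-exchangeable {M = M} v sparseD mt Bv (S-off v Sv) (degM v)

        module Exchange (v : Fin (n G)) (Sv : S v ≡ true) (f : Fin (e G)) (Df : D f ≡ true) (fB : within B f ≡ true)
                        (vf : at v f ≡ true) (Mf : M f ≡ false) where

          D' : ESet
          D' = exchange D g f

          admissibleD' : Admissible D'
          admissibleD' = sparse-exchange g f sparseD Dg mt Df fB ,
            λ i p → true-∧ (∪-introˡ (M⊑D i p)) (cong not
                (≢⇒== λ q → false≢true (trans (sym Mf) (subst (λ x → M x ≡ true) (sym q) p))))

          growsD' : ∀ w → degree D' w ≤ degree D w + ⟦ at w g ⟧
          growsD' w = m+n≤o⇒m≤o _ (≤-reflexive (size-exchange D (at w) g f Dg Df))

          drops : degree D' v < degree H v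
          drops = ≤-reflexive (trans (+-comm 1 _) (trans (subst₂ (λ x y → degree D' v + ⟦ x ⟧ ≡ degree D v + ⟦ y ⟧)
            vf (S-off v Sv) (size-exchange D (at v) g f Dg Df)) (trans (+-identityʳ _) (loadedD v Sv))))

          -- Above its bound, `v` would lose excess by the exchange while no other vertex gains any
          -- and the size stays, against the least potential.
          exchange-exact : degree H v ≤ h v
          exchange-exact = ≮⇒≥ λ over → <⇒≱ (better over) (least-potential D' admissibleD')
            where
            sizeD' : size D' ≡ size H
            sizeD' = trans (sym (edges-full D')) (trans
                (+-cancelʳ-≡ 1 (edges D' full) (edges D full) (size-exchange D (within full) g f Dg Df))
              (trans (edges-full D) sizeD))
            excess-< : h v < degree H v → excess D' < excess H
            excess-< over = sum-mono-< {f = λ w → degree D' w ∸ h w} {g = λ w → degree H w ∸ h w}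
                (excess-≤ D' growsD') v (∸-monoˡ-<′ (h v) drops over)
            deficit-≡ : deficit D' ≡ deficit H
            deficit-≡ = cong (λ x → m * n G ∸ (x + m)) sizeD'
            better : h v < degree H v → potential D' < potential H
            better over = +-mono-<-≤ {excess D'} {excess H} {deficit D'} {deficit H} (excess-< over)
                (≤-reflexive deficit-≡)

        exact : ∀ v → B v ≡ true → S v ≡ true → degree H v ≤ h v
        exact v Bv Sv = go (exchangeEdge v Bv Sv)
          where
          go : (Σ (Fin (e G)) λ f → D f ≡ true × within B f ≡ true × at v f ≡ true × M f ≡ false) → degree H v ≤ h v
          go (f , Df , fB , vf , Mf) = Exchange.exchange-exact v Sv f Df fB vf Mf

        -- Candidates for the merged part. They meet only parts met by `B`, so a vertex of `S` among
        -- them, being a part by itself, lies in `B`, where an exchange edge is available.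
        Hull : VSet → Set
        Hull W = Tight m D W × B ⊑ W × (∀ w → W w ≡ true → Σ (Fin (n G)) λ x → B x ≡ true × κ x ≡ κ w)

        respects : ∀ x v → Respects (part κ x) (part κ v)
        respects x v with κ x ≟ κ v
        ... | yes p = inj₁ λ w q → ==-complete {x = κ w} (trans (==-sound {x = κ w} q) p)
        ... | no p = inj₂ λ w q r → p (trans (sym (==-sound {x = κ w} q)) (==-sound {x = κ w} r))

        module _ (W : VSet) (hull : Hull W) (maximal : ∀ W' → Hull W' → size (∁ W) ≤ size (∁ W')) where

          -- A part met by `B` stays tight in `D`, since each relieved part coincides with it or is
          -- disjoint from it. Joining it to `W` gives another hull, so by maximality it is already
          -- inside `W`.
          closed : ∀ w w' → W w ≡ true → κ w' ≡ κ w → W w' ≡ true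
          closed w w' p q with proj₂ (proj₂ hull) w p
          ... | x , Bx , xw = not-injective (not-true λ out → false≢true (trans
                (sym (cong not (∪-introʳ {W w'} (==-complete (trans q (sym xw))))))
                (⊑-antisym-size {A = ∁ (W ∪ part κ x)} {∁ W} complement (maximal (W ∪ part κ x) larger) w' out)))
            where
            complement : ∁ (W ∪ part κ x) ⊑ ∁ W
            complement y r with W y
            ... | false = refl
            tightx : Tight m D (part κ x)
            tightx = mkTight (inhabited (tight x)) (subst (λ z → m * size (part κ x) ≤ z + m)
              (sym (edgesD (respects (src g) x) (respects (tgt g) x))) (saturated (tight x)))
            larger : Hull (W ∪ part κ x)
            larger = tight-∪ x sparseD (proj₁ hull) tightx (proj₁ (proj₂ hull) x Bx) (==-refl (κ x)) ,
              (λ y r → ∪-introˡ (proj₁ (proj₂ hull) y r)) ,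
              λ y r → case ∪-elim {W y} r of λ where
                (inj₁ Wy) → proj₂ (proj₂ hull) y Wy
                (inj₂ z) → x , Bx , sym (==-sound z)

          B⊑W : B ⊑ W
          B⊑W = proj₁ (proj₂ hull)
          gB : within B g ≡ true
          gB = proj₂ (proj₁ mt)
          srcW : W (src g) ≡ true
          srcW = B⊑W _ (within-src B g gB)
          tgtW : W (tgt g) ≡ true
          tgtW = B⊑W _ (within-tgt B g gB)
          K₁⊑W : K₁ ⊑ W
          K₁⊑W w p = closed (src g) w srcW (==-sound p)
          K₂⊑W : K₂ ⊑ W
          K₂⊑W w p = closed (tgt g) w tgtW (==-sound p)

          edgesW : edges D W ≡ edges H W
          edgesW = edgesD (inj₁ K₁⊑W) (inj₁ K₂⊑W)

          tightW : Tight m H W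
          tightW = mkTight (src g , srcW) (subst (λ z → m * size W ≤ z + m) edgesW (saturated (proj₁ hull)))

          WS⊑B : ∀ w → W w ≡ true → S w ≡ true → B w ≡ true
          WS⊑B w p q with proj₂ (proj₂ hull) w p
          ... | x , Bx , xw = subst (λ z → B z ≡ true) (single w x q xw) Bx

          fitsW : ∀ w → W w ≡ true → degree H w ≤ h w
          fitsW w p with true-or-false (S w)
          ... | inj₁ q = exact w (WS⊑B w p q) q
          ... | inj₂ q = fitsSt w q

          -- Both edges lie inside `W`. The vertex `v` loses `f` and is no end of `g`, while the
          -- ends of `g` can afford it by their slack in `D`.
          relievable-exchange : ∀ v → W v ≡ true → (Sv : S v ≡ true) → ∀ f → (Df : D f ≡ true) →
              (fB : within B f ≡ true) →
                                (vf : at v f ≡ true) → (Mf : M f ≡ false) → Relievable W v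
          relievable-exchange v Wv Sv f Df fB vf Mf = record
            { H' = D' ; admissible = admissibleD' ; agree = agree' ; count = count'
            ; slack = ≤-trans drops (fitsW v Wv) ; fits = fits'' }
            where
            open Exchange v Sv f Df fB vf Mf
            fW : within W f ≡ true
            fW = within-mono B⊑W f fB
            gW : within W g ≡ true
            gW = within-mono B⊑W g gB
            agree' : AgreeOff W D' H
            agree' i p = trans (cong₂ (λ x y → (D i ∨ x) ∧ not y)
                  (≢⇒== {x = g} {i} λ z → false≢true (trans (sym p) (subst (λ x → within W x ≡ true) z gW)))
                  (≢⇒== {x = f} {i} λ z → false≢true (trans (sym p) (subst (λ x → within W x ≡ true) z fW))))
              (trans (∧-identityʳ _) (trans (∨-identityʳ (D i)) (D-off i
                  (not-true λ z → false≢true (trans (sym p) (within-mono K₁⊑W i z)))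
                  (not-true λ z → false≢true (trans (sym p) (within-mono K₂⊑W i z))))))
            count' : edges D' W ≡ edges H W
            count' = trans (+-cancelʳ-≡ 1 _ _ (subst₂ (λ x y → edges D' W + ⟦ x ⟧ ≡ edges D W + ⟦ y ⟧) fW gW
              (size-exchange D (within W) g f Dg Df))) edgesW
            fits'' : ∀ w → W w ≡ true → degree D' w ≤ h w
            fits'' w p with true-or-false (S w)
            ... | inj₁ r = ≤-trans (loaded' D' growsD' w r) (fitsW w p)
            ... | inj₂ r = fits' D' growsD' w r

          relievableW : ∀ v → W v ≡ true → Relievable W v
          relievableW v Wv with true-or-false (S v)
          ... | inj₂ q = relievable-mono (λ w p → closed v w Wv (==-sound p)) fitsW (relievableSt v q)
          ... | inj₁ q = go (exchangeEdge v (WS⊑B v Wv q) q)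
            where
            go : (Σ (Fin (e G)) λ f → D f ≡ true × within B f ≡ true × at v f ≡ true × M f ≡ false) → Relievable W v
            go (f , Df , fB , vf , Mf) = relievable-exchange v Wv q f Df fB vf Mf

          κ' : Fin (n G) → Fin (n G)
          κ' w = if W w then κ (src g) else κ w

          κ'-in : ∀ w → W w ≡ true → κ' w ≡ κ (src g)
          κ'-in w p rewrite p = refl

          κ'-out : ∀ w → W w ≡ false → κ' w ≡ κ w
          κ'-out w p rewrite p = refl

          W-κ : ∀ w → W (κ w) ≡ W w
          W-κ w = bool-ext (λ p → closed (κ w) w p (sym (idem w))) (λ p → closed w (κ w) p (idem w))

          part'-in : ∀ v w → W v ≡ true → κ' w ≡ κ' v → W w ≡ true
          part'-in v w p q with true-or-false (W w)
          ... | inj₁ r = r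
          ... | inj₂ r = closed (src g) w srcW (trans (sym (κ'-out w r)) (trans q (κ'-in v p)))

          part'-out : ∀ v w → W v ≡ false → κ' w ≡ κ' v → κ w ≡ κ v
          part'-out v w p q with true-or-false (W w)
          ... | inj₁ r = ⊥-elim (false≢true (trans (sym p) (part'-in w v r (sym q))))
          ... | inj₂ r = trans (sym (κ'-out w r)) (trans q (κ'-out v p))

          part-out : ∀ v w → W v ≡ false → κ w ≡ κ v → κ' w ≡ κ' v
          part-out v w p q = trans (κ'-out w (not-true λ r → false≢true (trans (sym p) (closed w v r (sym q)))))
              (trans q (sym (κ'-out v p)))

          S' : VSet
          S' w = S w ∧ not (W w)

          S'-out : ∀ w → S' w ≡ true → S w ≡ true × W w ≡ false
          S'-out w p = proj₁ (∧-true {S w} p) , not-injective (proj₂ (∧-true {S w} p))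

          S'-false : ∀ w → S' w ≡ false → W w ≡ false → S w ≡ false
          S'-false w p q = not-true λ r → false≢true (trans (sym p) (true-∧ r (cong not q)))

          mergedStage : Stage
          mergedStage = record
            { κ = κ' ; S = S' ; idem = idem' ; tight = tight' ; single = single' ; loaded = λ v p → loaded v
                (proj₁ (S'-out v p))
            ; fits = fitsS' ; relievable = relievable' }
            where
            idem' : ∀ v → κ' (κ' v) ≡ κ' v
            idem' v with true-or-false (W v)
            ... | inj₁ p = trans (cong κ' (κ'-in v p))
                (trans (κ'-in (κ (src g)) (trans (W-κ _) srcW)) (sym (κ'-in v p)))
            ... | inj₂ p = trans (cong κ' (κ'-out v p))
                (trans (κ'-out (κ v) (trans (W-κ v) p)) (trans (idem v) (sym (κ'-out v p))))
            tight' : ∀ v → Tight m H (part κ' v)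
            tight' v with true-or-false (W v)
            ... | inj₁ p = tight-cong (λ _ → refl) (λ w → bool-ext {W w}
                (λ q → ==-complete (trans (κ'-in w q) (sym (κ'-in v p))))
                             (λ q → part'-in v w p (==-sound q))) tightW
            ... | inj₂ p = tight-cong (λ _ → refl) (λ w → bool-ext {part κ v w}
                (λ q → ==-complete (part-out v w p (==-sound q)))
                             (λ q → ==-complete (part'-out v w p (==-sound q)))) (tight v)
            single' : ∀ v w → S' v ≡ true → κ' w ≡ κ' v → w ≡ v
            single' v w p q = single v w (proj₁ (S'-out v p)) (part'-out v w (proj₂ (S'-out v p)) q)
            fitsS' : ∀ v → S' v ≡ false → degree H v ≤ h v
            fitsS' v p with true-or-false (W v)
            ... | inj₁ q = fitsW v q
            ... | inj₂ q = fitsSt v (S'-false v p q)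
            relievable' : ∀ v → S' v ≡ false → Relievable (part κ' v) v
            relievable' v p with true-or-false (W v)
            ... | inj₁ q = relievable-cong (λ w r → ==-complete (trans (κ'-in w r) (sym (κ'-in v q))))
                             (λ w r → part'-in v w q (==-sound r)) (relievableW v q)
            ... | inj₂ q = relievable-cong (λ w r → ==-complete (part-out v w q (==-sound r)))
                             (λ w r → ==-complete (part'-out v w q (==-sound r))) (relievableSt v (S'-false v p q))

          fewer-parts : size (fixed κ') < size (fixed κ)
          -- The representative `κ (tgt g)` is lost: it now maps to `κ (src g)`.
          fewer-parts = size-mono-< {A = fixed κ'} {fixed κ} sub (κ (tgt g))
              (≢⇒== λ p → κg (trans (sym (κ'-in (κ (tgt g)) (trans (W-κ _) tgtW))) p)) (==-complete (idem _))
            where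
            sub : fixed κ' ⊑ fixed κ
            sub v p with true-or-false (W v)
            ... | inj₁ q = subst (λ w → fixed κ w ≡ true) (trans (sym (κ'-in v q)) (==-sound p))
                (==-complete (idem (src g)))
            ... | inj₂ q = ==-complete (trans (sym (κ'-out v q)) (==-sound p))

      merge : ¬ ¬ Σ Stage λ st' → size (fixed (Stage.κ st')) < size (fixed κ)
      merge k = em {P = Σ VSet λ A → Tight m D A × within A g ≡ true} λ where
        (no none) → no-insertion λ A t w → none (A , t , w)
        (yes (A , tA)) → least (λ A → Tight m D A × within A g ≡ true) size tA λ { (B , mt) →
          least (Hull B mt) (λ W → size (∁ W)) (proj₁ (proj₁ mt) , (λ _ p → p) , λ w p → w , p , refl) λ {
              (W , hull , mx) →
            k (mergedStage B mt W hull mx , fewer-parts B mt W hull mx) } }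

    Closed : Stage → Set
    Closed st = ∀ i → κ (src i) ≢ κ (tgt i) → S (src i) ≡ false → S (tgt i) ≡ false → H i ≡ true
      where open Stage st

    -- A missing edge between two relievable parts permits a merger, so a stage with the fewest
    -- parts has none.
    closedStage : Admissible H → (∀ D → Admissible D → potential H ≤ potential D) → ¬ ¬ Σ Stage Closed
    closedStage adm mn k = least {A = Stage} (λ _ → Unit.⊤)
        (λ st → size (fixed (Stage.κ st))) {initialStage adm} tt λ { (st , _ , few) →
      k (st , λ i ne p q → decidable-stable (_ Bool.≟ true) λ Hi →
        Merge.merge mn st i ne p q (Relieve.relieved st i (not-true Hi) ne p q) λ { (st' , lt) → <⇒≱ lt
            (few st' tt) }) }

  -- The search is over a nonempty family, as `M` itself is admissible. Potential 0 means that no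
  -- bound is exceeded and no edge is missing.
  descent : Sparse m M → (∀ H → Admissible H → (st : Stage H) → Closed H st → 1 ≤ potential H → ⊥) →
            ¬ ¬ Σ ESet λ H → Admissible H × (∀ v → degree H v ≤ h v) × m * n G ≤ size H + m
  descent spM refute k = least Admissible potential (spM , λ _ p → p) λ { (H , adm , mn) →
    closedStage H adm mn λ { (st , cl) → k (H , adm , solved H (n<1⇒n≡0 (≰⇒> (refute H adm st cl)))) } }
    where
    solved : ∀ H → potential H ≡ 0 → (∀ v → degree H v ≤ h v) × m * n G ≤ size H + m
    solved H z = (λ v → m∸n≡0⇒m≤n (n≤0⇒n≡0 (≤-trans (sum-≥ (λ v → degree H v ∸ h v) v)
        (≤-reflexive (m+n≡0⇒m≡0 _ z))))) ,
                 m∸n≡0⇒m≤n (m+n≡0⇒n≡0 (excess H) z)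

-- Edges between the parts of a terminal partition

module Counting (G : Graph) where

  open Sparsity G
  open Connectivity G

  all : ESet
  all _ = true

  degree-sum : ∀ (H : ESet) (A : VSet) → sum (λ v → ⟦ A v ⟧ * degree H v) ≡ sum
      (λ i → ⟦ H i ⟧ * (⟦ A (src i) ⟧ + ⟦ A (tgt i) ⟧))
  degree-sum H A = begin
      sum (λ v → ⟦ A v ⟧ * degree H v) ≡⟨ sum-cong {n G} (λ v → *-distribˡ-sum ⟦ A v ⟧ (λ i → ⟦ (H ∩ at v) i ⟧)) ⟩
      sum (λ v → sum (λ i → ⟦ A v ⟧ * ⟦ (H ∩ at v) i ⟧)) ≡⟨ ∑-comm (λ v i → ⟦ A v ⟧ * ⟦ (H ∩ at v) i ⟧) ⟩
      sum (λ i → sum (λ v → ⟦ A v ⟧ * ⟦ (H ∩ at v) i ⟧)) ≡⟨ sum-cong {e G} ends-of ⟩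
      sum (λ i → ⟦ H i ⟧ * (⟦ A (src i) ⟧ + ⟦ A (tgt i) ⟧)) ∎
    where
    open ≡-Reasoning
    ends-of : ∀ i → sum (λ v → ⟦ A v ⟧ * ⟦ (H ∩ at v) i ⟧) ≡ ⟦ H i ⟧ * (⟦ A (src i) ⟧ + ⟦ A (tgt i) ⟧)
    ends-of i = begin
        sum (λ v → ⟦ A v ⟧ * ⟦ (H ∩ at v) i ⟧) ≡⟨ sum-cong {n G} point ⟩
        sum (λ v → ⟦ src i == v ⟧ * ⟦ H i ∧ A v ⟧ + ⟦ tgt i == v ⟧ * ⟦ H i ∧ A v ⟧)
          ≡⟨ ∑-distrib-+ (λ v → ⟦ src i == v ⟧ * ⟦ H i ∧ A v ⟧) (λ v → ⟦ tgt i == v ⟧ * ⟦ H i ∧ A v ⟧) ⟩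
        sum (λ v → ⟦ src i == v ⟧ * ⟦ H i ∧ A v ⟧) + sum (λ v → ⟦ tgt i == v ⟧ * ⟦ H i ∧ A v ⟧)
          ≡⟨ cong₂ _+_ (sum-delta (src i) (λ v → ⟦ H i ∧ A v ⟧)) (sum-delta (tgt i) (λ v → ⟦ H i ∧ A v ⟧)) ⟩
        ⟦ H i ∧ A (src i) ⟧ + ⟦ H i ∧ A (tgt i) ⟧ ≡⟨ ≡ᵇ⇒≡ _ _
            (truth-table 3 (λ h a b → (⟦ h ∧ a ⟧ + ⟦ h ∧ b ⟧) ≡ᵇ (⟦ h ⟧ * (⟦ a ⟧ + ⟦ b ⟧))) tt (H i) (A (src i))
            (A (tgt i))) ⟩
        ⟦ H i ⟧ * (⟦ A (src i) ⟧ + ⟦ A (tgt i) ⟧) ∎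
      where
      -- A loop would count once in `at` but twice among the ends.
      disjoint : ∀ v → (src i == v) ∧ (tgt i == v) ≡ false
      disjoint v = not-true λ p → loopless G i (trans (==-sound (proj₁ (∧-true {src i == v} p)))
          (sym (==-sound (proj₂ (∧-true {src i == v} p)))))
      table : ∀ a h x y → x ∧ y ≡ false → ⟦ a ⟧ * ⟦ h ∧ (x ∨ y) ⟧ ≡ ⟦ x ⟧ * ⟦ h ∧ a ⟧ + ⟦ y ⟧ * ⟦ h ∧ a ⟧
      table a h true false _ = ≡ᵇ⇒≡ _ _ (truth-table 2 (λ a h → (⟦ a ⟧ * ⟦ h ∧ true ⟧) ≡ᵇ (1 * ⟦ h ∧ a ⟧ + 0)) tt a h)
      table a h false true _ = ≡ᵇ⇒≡ _ _ (truth-table 2 (λ a h → (⟦ a ⟧ * ⟦ h ∧ true ⟧) ≡ᵇ (1 * ⟦ h ∧ a ⟧)) tt a h)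
      table a h false false _ = ≡ᵇ⇒≡ _ _ (truth-table 2 (λ a h → (⟦ a ⟧ * ⟦ h ∧ false ⟧) ≡ᵇ 0) tt a h)
      point : ∀ v → ⟦ A v ⟧ * ⟦ (H ∩ at v) i ⟧ ≡ ⟦ src i == v ⟧ * ⟦ H i ∧ A v ⟧ + ⟦ tgt i == v ⟧ * ⟦ H i ∧ A v ⟧
      point v = table (A v) (H i) (src i == v) (tgt i == v) (disjoint v)

  -- Counting ends, twice the edges inside `A` is at most m |A|; if there is such an edge then |A| ≥
  -- 2, so 2m ≤ m |A| as well.
  sparse-of-degree : ∀ {m M} → (∀ v → degree M v ≤ m) → Sparse m M
  sparse-of-degree {m} {M} dM = mkSparse go
    where
    open ≤-Reasoning
    double : ∀ A → 2 * edges M A ≤ m * size A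
    double A = begin
      2 * edges M A ≡⟨ *-distribˡ-sum 2 (λ i → ⟦ (M ∩ within A) i ⟧) ⟩
      sum (λ i → 2 * ⟦ (M ∩ within A) i ⟧) ≤⟨ sum-mono {e G}
          (λ i → ≤ᵇ⇒≤ _ _ (truth-table 3 (λ h a b → (2 * ⟦ h ∧ a ∧ b ⟧) ≤ᵇ (⟦ h ⟧ * (⟦ a ⟧ + ⟦ b ⟧))) tt (M i)
          (A (src i)) (A (tgt i)))) ⟩
      sum (λ i → ⟦ M i ⟧ * (⟦ A (src i) ⟧ + ⟦ A (tgt i) ⟧)) ≡⟨ degree-sum M A ⟨
      sum (λ v → ⟦ A v ⟧ * degree M v) ≤⟨ sum-mono {n G}
          (λ v → ≤-trans (*-monoʳ-≤ ⟦ A v ⟧ (dM v)) (≤-reflexive (*-comm ⟦ A v ⟧ m))) ⟩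
      sum (λ v → m * ⟦ A v ⟧) ≡⟨ *-distribˡ-sum m (λ v → ⟦ A v ⟧) ⟨
      m * size A ∎
    go : ∀ A v → A v ≡ true → edges M A + m ≤ m * size A
    go A v av with edges M A in eq
    ... | zero = ≤-trans (≤-reflexive (sym (*-identityʳ m))) (*-monoʳ-≤ m (size-pos A v av))
    ... | suc x = *-cancelˡ-≤ 2 (begin
        2 * (suc x + m) ≡⟨ *-distribˡ-+ 2 (suc x) m ⟩
        2 * suc x + 2 * m ≤⟨ +-mono-≤ (subst (λ y → 2 * y ≤ m * size A) eq (double A))
            (≤-trans (≤-reflexive (*-comm 2 m)) (*-monoʳ-≤ m two)) ⟩
        m * size A + m * size A ≡⟨ cong (λ x → m * size A + x) (+-identityʳ (m * size A)) ⟨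
        2 * (m * size A) ∎)
      where
      two : 2 ≤ size A
      two with size-witness (M ∩ within A) (subst (1 ≤_) (sym eq) (s≤s z≤n))
      ... | i , p = subst (_< size A) (size-⟨⟩ (src i)) (size-mono-< {A = ⟨ src i ⟩} {A}
              (λ w q → subst (λ x → A x ≡ true) (==-sound q) (within-src A i iA)) (tgt i) (≢⇒== (loopless G i))
                  (within-tgt A i iA))
        where
        iA = proj₂ (∧-true {M i} p)

  module Certificate {m : ℕ} {M : ESet} {h : Fin (n G) → ℕ} (degM : ∀ v → degree M v ≤ m) where
    open Descent G m M h degM

    module _ {H : ESet} (adm : Admissible H) (st : Stage H) (closed : Closed H st) (defect : 1 ≤ potential H)
        (v₀ : Fin (n G)) where
      open Stage st

      p a aG c D hS : ℕ
      p = size (fixed κ)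
      a = edges H S
      aG = size (within S)
      D = sum λ v → ⟦ S v ⟧ * degree all v
      hS = sum λ v → ⟦ S v ⟧ * h v

      free : ESet
      free i = crossing κ i ∧ (not (S (src i)) ∧ not (S (tgt i)))
      c = size free

      S-not-inner : ∀ i → S (src i) ∨ S (tgt i) ≡ true → crossing κ i ≡ true
      S-not-inner i q = cong not (≢⇒== λ eq → case ∪-elim {S (src i)} q of λ where
        (inj₁ s) → loopless G i (sym (single (src i) (tgt i) s (sym eq)))
        (inj₂ t) → loopless G i (single (tgt i) (src i) t eq))

      S-κ : ∀ v → S (κ v) ≡ S v
      S-κ v = bool-ext (λ q → subst (λ w → S w ≡ true) (sym (single (κ v) v q (sym (idem v)))) q)
                       (λ q → subst (λ w → S w ≡ true) (sym (single v (κ v) q (idem v))) q)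

      class : Fin (n G) → VSet
      class r w = κ w == r

      inner : ESet
      inner i = κ (tgt i) == κ (src i)

      -- Tightness summed over the parts. The sum runs over all vertices `r`; the class of `r` is
      -- empty unless `r` is a representative.
      parts-count : m * n G ≤ size (H ∩ inner) + m * p
      parts-count = begin
          m * n G ≡⟨ cong (m *_) covered ⟨
          m * sum (λ r → size (class r)) ≡⟨ *-distribˡ-sum m (λ r → size (class r)) ⟩
          sum (λ r → m * size (class r)) ≤⟨ sum-mono {n G} each ⟩
          sum (λ r → edges H (class r) + m * ⟦ fixed κ r ⟧) ≡⟨ ∑-distrib-+ (λ r → edges H (class r))
              (λ r → m * ⟦ fixed κ r ⟧) ⟩
          sum (λ r → edges H (class r)) + sum (λ r → m * ⟦ fixed κ r ⟧) ≡⟨ cong₂ _+_ inside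
              (sym (*-distribˡ-sum m (λ r → ⟦ fixed κ r ⟧))) ⟩
          size (H ∩ inner) + m * p ∎
        where
        open ≤-Reasoning
        covered : sum (λ r → size (class r)) ≡ n G
        covered = trans (∑-comm (λ r w → ⟦ class r w ⟧))
            (trans (sum-cong {n G} (λ w → size-⟨⟩ (κ w))) (size-full (n G)))
        inside : sum (λ r → edges H (class r)) ≡ size (H ∩ inner)
        inside = trans (∑-comm (λ r i → ⟦ (H ∩ within (class r)) i ⟧)) (sum-cong {e G} λ i →
          trans (sum-cong {n G} λ r → ≡ᵇ⇒≡ _ _ (truth-table 3 (λ h x y → ⟦ h ∧ x ∧ y ⟧ ≡ᵇ (⟦ x ⟧ * ⟦ h ∧ y ⟧)) tt
              (H i) (κ (src i) == r) (κ (tgt i) == r)))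
            (sum-delta (κ (src i)) (λ r → ⟦ H i ∧ (κ (tgt i) == r) ⟧)))
        each : ∀ r → m * size (class r) ≤ edges H (class r) + m * ⟦ fixed κ r ⟧
        each r with true-or-false (fixed κ r)
        ... | inj₁ f = subst (λ x → m * size (class r) ≤ edges H (class r) + x)
            (trans (sym (*-identityʳ m)) (cong (λ b → m * ⟦ b ⟧) (sym f)))
                         (subst (λ z → m * size (class z) ≤ edges H (class z) + m) (==-sound f) (saturated (tight r)))
        ... | inj₂ f = subst (_≤ edges H (class r) + m * ⟦ fixed κ r ⟧)
            (sym (trans (cong (m *_) (sum-zero {f = λ w → ⟦ class r w ⟧}
                         λ w → cong ⟦_⟧ (not-true λ q → false≢true
                             (trans (sym f) (subst (λ z → (κ z == z) ≡ true) (==-sound q)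
                             (==-complete (idem w))))))) (*-zeroʳ m))) z≤n

      -- Of the m(n - 1) - `deficit H` edges of `H`, at least m(n - p) lie inside parts.
      crossing-count : size (H ∩ crossing κ) + deficit H + m ≤ m * p
      crossing-count = +-cancelʳ-≤ (size (H ∩ inner)) _ _ (begin
          size (H ∩ crossing κ) + deficit H + m + size (H ∩ inner) ≡⟨ r1 (size (H ∩ crossing κ)) (deficit H) m
              (size (H ∩ inner)) ⟩
          deficit H + (size (H ∩ crossing κ) + size (H ∩ inner) + m) ≡⟨ cong (λ x → deficit H + (x + m)) split ⟩
          deficit H + (size H + m) ≡⟨ m∸n+n≡m (sparse-total (proj₁ adm) v₀) ⟩
          m * n G ≤⟨ parts-count ⟩
          size (H ∩ inner) + m * p ≡⟨ +-comm (size (H ∩ inner)) _ ⟩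
          m * p + size (H ∩ inner) ∎)
        where
        open ≤-Reasoning
        r1 : ∀ x d m y → x + d + m + y ≡ d + (x + y + m)
        r1 = solve-∀
        split : size (H ∩ crossing κ) + size (H ∩ inner) ≡ size H
        split = trans (sym (∑-distrib-+ (λ i → ⟦ (H ∩ crossing κ) i ⟧) (λ i → ⟦ (H ∩ inner) i ⟧))) (sum-cong {e G} λ i →
          trans (cong (λ b → ⟦ H i ∧ not (κ (src i) == κ (tgt i)) ⟧ + ⟦ H i ∧ b ⟧) (==-sym (κ (tgt i)) (κ (src i))))
            (≡ᵇ⇒≡ _ _ (truth-table 2 (λ h x → (⟦ h ∧ not x ⟧ + ⟦ h ∧ x ⟧) ≡ᵇ ⟦ h ⟧) tt (H i) (κ (src i) == κ (tgt i)))))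

      -- All edges at `S` cross, since its vertices are singleton parts, and by `closed` all free
      -- edges belong to `H`. The degree sum over `S` counts the edges inside `S` twice, hence the
      -- extra `a`.
      load-count : hS + excess H + c ≤ size (H ∩ crossing κ) + a
      load-count = begin
          hS + excess H + c ≡⟨ cong (_+ c) (∑-distrib-+ (λ v → ⟦ S v ⟧ * h v) (λ v → degree H v ∸ h v)) ⟨
          sum (λ v → ⟦ S v ⟧ * h v + (degree H v ∸ h v)) + c ≤⟨ +-monoˡ-≤ c (sum-mono {n G} vertex) ⟩
          sum (λ v → ⟦ S v ⟧ * degree H v) + c ≡⟨ cong (_+ c) (degree-sum H S) ⟩
          sum (λ i → ⟦ H i ⟧ * (⟦ S (src i) ⟧ + ⟦ S (tgt i) ⟧)) + c ≤⟨ sum-+-mono {e G} edge ⟩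
          size (H ∩ crossing κ) + a ∎
        where
        open ≤-Reasoning
        vertex : ∀ v → ⟦ S v ⟧ * h v + (degree H v ∸ h v) ≤ ⟦ S v ⟧ * degree H v
        vertex v with true-or-false (S v)
        ... | inj₁ q rewrite q | +-identityʳ (h v) | +-identityʳ (degree H v) = ≤-reflexive (m+[n∸m]≡n (loaded v q))
        ... | inj₂ q rewrite q = ≤-reflexive (m≤n⇒m∸n≡0 (fits v q))
        table : ∀ h x s t → (s ∨ t ≡ true → x ≡ true) → (x ≡ true → s ≡ false → t ≡ false → h ≡ true) →
                ⟦ h ⟧ * (⟦ s ⟧ + ⟦ t ⟧) + ⟦ x ∧ not s ∧ not t ⟧ ≤ ⟦ h ∧ x ⟧ + ⟦ h ∧ s ∧ t ⟧
        table h true false false _ f rewrite f refl refl refl = ≤-refl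
        table h false false false _ f = ≤ᵇ⇒≤ _ _ (truth-table 1
            (λ h → (⟦ h ⟧ * 0 + 0) ≤ᵇ (⟦ h ∧ false ⟧ + ⟦ h ∧ false ⟧)) tt h)
        table h x true t f _ rewrite f refl = ≤ᵇ⇒≤ _ _
            (truth-table 2 (λ h t → (⟦ h ⟧ * (1 + ⟦ t ⟧) + 0) ≤ᵇ (⟦ h ∧ true ⟧ + ⟦ h ∧ true ∧ t ⟧)) tt h t)
        table h x false true f _ rewrite f refl = ≤ᵇ⇒≤ _ _
            (truth-table 1 (λ h → (⟦ h ⟧ * 1 + 0) ≤ᵇ (⟦ h ∧ true ⟧ + ⟦ h ∧ false ⟧)) tt h)
        edge : ∀ i → ⟦ H i ⟧ * (⟦ S (src i) ⟧ + ⟦ S (tgt i) ⟧) + ⟦ free i ⟧ ≤ ⟦ (H ∩ crossing κ) i ⟧ + ⟦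
            (H ∩ within S) i ⟧
        edge i = table (H i) (crossing κ i) (S (src i)) (S (tgt i)) (S-not-inner i)
          λ x → closed i λ q → false≢true (trans (sym (cong not (==-complete q))) x)

      -- Excess and deficit add up to at least one, and this is the whole strictness of the count.
      certificate : hS + c + m + 1 ≤ m * p + a
      certificate = begin
          hS + c + m + 1 ≤⟨ +-monoʳ-≤ (hS + c + m) defect ⟩
          hS + c + m + (excess H + deficit H) ≡⟨ r1 hS c m (excess H) (deficit H) ⟩
          (hS + excess H + c) + (deficit H + m) ≤⟨ +-monoˡ-≤ (deficit H + m) load-count ⟩
          size (H ∩ crossing κ) + a + (deficit H + m) ≡⟨ r2 (size (H ∩ crossing κ)) a (deficit H) m ⟩
          size (H ∩ crossing κ) + deficit H + m + a ≤⟨ +-monoˡ-≤ a crossing-count ⟩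
          m * p + a ∎
        where
        open ≤-Reasoning
        r1 : ∀ hS c m x d → hS + c + m + (x + d) ≡ (hS + x + c) + (d + m)
        r1 = solve-∀
        r2 : ∀ x a d m → x + a + (d + m) ≡ x + d + m + a
        r2 = solve-∀

      a≤aG : a ≤ aG
      a≤aG = size-mono {A = H ∩ within S} λ i q → proj₂ (∧-true {H i} q)

      D-edges : D ≡ sum (λ i → ⟦ S (src i) ⟧ + ⟦ S (tgt i) ⟧)
      D-edges = trans (degree-sum all S) (sum-cong {e G} λ i → +-identityʳ _)

      -- A crossing edge meets `S` or is free, and `D` counts the edges inside `S` twice.
      tree-count : ∀ {k} → GTreeConnected G k → k * p + aG ≤ D + c + k
      tree-count {k} conn = begin
          k * p + aG ≤⟨ +-monoˡ-≤ aG (treeConnected-crossing conn κ idem v₀) ⟩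
          size (crossing κ) + k + aG ≡⟨ r1 (size (crossing κ)) k aG ⟩
          size (crossing κ) + aG + k ≤⟨ +-monoˡ-≤ k (sum-+-mono {e G} λ i → ≤ᵇ⇒≤ _ _ (truth-table 3
            (λ x s t → (⟦ x ⟧ + ⟦ s ∧ t ⟧) ≤ᵇ ((⟦ s ⟧ + ⟦ t ⟧) + ⟦ x ∧ not s ∧ not t ⟧)) tt (crossing κ i)
                (S (src i)) (S (tgt i)))) ⟩
          sum (λ i → ⟦ S (src i) ⟧ + ⟦ S (tgt i) ⟧) + c + k ≡⟨ cong (λ x → x + c + k) D-edges ⟨
          D + c + k ∎
        where
        open ≤-Reasoning
        r1 : ∀ x k a → x + k + a ≡ x + a + k
        r1 = solve-∀

      -- Only parts outside `S` are charged for their boundaries: a free edge is charged twice, an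
      -- edge with one end in `S` once, an edge inside `S` never. The assumption on `b` is there
      -- because a part equal to the whole vertex set has no boundary.
      edge-count : ∀ {k} → EdgeConnected G k → (∀ r → fixed κ r ≡ true → S r ≡ false → Σ (Fin (n G)) λ b → κ b ≢ r) →
                   k * p + 2 * aG ≤ D + 2 * c + k * size S
      edge-count {k} conn other = begin
          k * p + 2 * aG ≤⟨ +-monoˡ-≤ (2 * aG) (*-monoʳ-≤ k parts) ⟩
          k * (size outer + size S) + 2 * aG ≡⟨ r1 k (size outer) (size S) (2 * aG) ⟩
          (k * size outer + 2 * aG) + k * size S ≤⟨ +-monoˡ-≤ (k * size S) (+-monoˡ-≤ (2 * aG) boundaries) ⟩
          (sum (λ r → ⟦ outer r ⟧ * size (boundary (class r))) + 2 * aG) + k * size S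
            ≤⟨ +-monoˡ-≤ (k * size S) (+-mono-≤ boundary-edges
                (≤-reflexive (*-distribˡ-sum 2 (λ i → ⟦ within S i ⟧)))) ⟩
          (sum (λ i → ⟦ crossing κ i ⟧ * (⟦ not (S (src i)) ⟧ + ⟦ not (S (tgt i)) ⟧)) + sum
              (λ i → 2 * ⟦ within S i ⟧)) + k * size S
            ≤⟨ +-monoˡ-≤ (k * size S) (sum-+-mono {e G} λ i → ≤ᵇ⇒≤ _ _ (truth-table 3
              (λ x s t → (⟦ x ⟧ * (⟦ not s ⟧ + ⟦ not t ⟧) + 2 * ⟦ s ∧ t ⟧) ≤ᵇ
                  ((⟦ s ⟧ + ⟦ t ⟧) + 2 * ⟦ x ∧ not s ∧ not t ⟧)) tt (crossing κ i) (S (src i)) (S (tgt i)))) ⟩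
          (sum (λ i → ⟦ S (src i) ⟧ + ⟦ S (tgt i) ⟧) + sum (λ i → 2 * ⟦ free i ⟧)) + k * size S
            ≡⟨ cong₂ (λ x y → x + y + k * size S) D-edges (*-distribˡ-sum 2 (λ i → ⟦ free i ⟧)) ⟨
          D + 2 * c + k * size S ∎
        where
        open ≤-Reasoning
        outer : VSet
        outer r = fixed κ r ∧ not (S r)
        r1 : ∀ k x y z → k * (x + y) + z ≡ (k * x + z) + k * y
        r1 = solve-∀
        parts : p ≤ size outer + size S
        parts = subst (p ≤_) (∑-distrib-+ (λ r → ⟦ outer r ⟧) (λ r → ⟦ S r ⟧)) (sum-mono {n G} λ r →
          ≤ᵇ⇒≤ _ _ (truth-table 2 (λ f s → ⟦ f ⟧ ≤ᵇ (⟦ f ∧ not s ⟧ + ⟦ s ⟧)) tt (fixed κ r) (S r)))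
        boundaries : k * size outer ≤ sum (λ r → ⟦ outer r ⟧ * size (boundary (class r)))
        boundaries = subst (_≤ sum (λ r → ⟦ outer r ⟧ * size (boundary (class r))))
            (sym (*-distribˡ-sum k (λ r → ⟦ outer r ⟧))) (sum-mono {n G} each)
          where
          each : ∀ r → k * ⟦ outer r ⟧ ≤ ⟦ outer r ⟧ * size (boundary (class r))
          each r with true-or-false (outer r)
          ... | inj₂ q = subst (λ b → k * ⟦ b ⟧ ≤ ⟦ b ⟧ * size (boundary (class r))) (sym q) (≤-reflexive (*-zeroʳ k))
          ... | inj₁ q with ∧-true {fixed κ r} q
          ... | f , s with other r f (not-injective s)
          ... | b , ne = subst (λ b → k * ⟦ b ⟧ ≤ ⟦ b ⟧ * size (boundary (class r))) (sym q)
              (subst₂ _≤_ (sym (*-identityʳ k)) (sym (*-identityˡ _))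
                  (edgeConnected-boundary conn (class r) r b f (≢⇒== ne)))
        boundary-edges : sum (λ r → ⟦ outer r ⟧ * size (boundary (class r))) ≤
                         sum (λ i → ⟦ crossing κ i ⟧ * (⟦ not (S (src i)) ⟧ + ⟦ not (S (tgt i)) ⟧))
        boundary-edges = begin
            sum (λ r → ⟦ outer r ⟧ * size (boundary (class r))) ≡⟨ sum-cong {n G}
                (λ r → *-distribˡ-sum ⟦ outer r ⟧ (λ i → ⟦ boundary (class r) i ⟧)) ⟩
            sum (λ r → sum (λ i → ⟦ outer r ⟧ * ⟦ boundary (class r) i ⟧)) ≡⟨ ∑-comm
                (λ r i → ⟦ outer r ⟧ * ⟦ boundary (class r) i ⟧) ⟩
            sum (λ i → sum (λ r → ⟦ outer r ⟧ * ⟦ boundary (class r) i ⟧)) ≤⟨ sum-mono {e G} each ⟩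
            sum (λ i → ⟦ crossing κ i ⟧ * (⟦ not (S (src i)) ⟧ + ⟦ not (S (tgt i)) ⟧)) ∎
          where
          each : ∀ i → sum (λ r → ⟦ outer r ⟧ * ⟦ boundary (class r) i ⟧) ≤ ⟦ crossing κ i ⟧ *
              (⟦ not (S (src i)) ⟧ + ⟦ not (S (tgt i)) ⟧)
          each i with κ (src i) ≟ κ (tgt i)
          ... | yes eq = ≤-reflexive (sum-zero {n G} λ r → trans (cong (λ b → ⟦ outer r ⟧ * ⟦ b ⟧)
                  (trans (cong (λ z → (z == r) xor (κ (tgt i) == r)) eq) (xor-same (κ (tgt i) == r))))
                      (*-zeroʳ ⟦ outer r ⟧))
          ... | no _ = begin
                sum (λ r → ⟦ outer r ⟧ * ⟦ boundary (class r) i ⟧) ≤⟨ sum-mono {n G} (λ r → ≤ᵇ⇒≤ _ _ (truth-table 4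
                  (λ f s x y → (⟦ f ∧ not s ⟧ * ⟦ x xor y ⟧) ≤ᵇ (⟦ x ⟧ * ⟦ not s ⟧ + ⟦ y ⟧ * ⟦ not s ⟧)) tt
                      (fixed κ r) (S r) (κ (src i) == r) (κ (tgt i) == r))) ⟩
                sum (λ r → ⟦ κ (src i) == r ⟧ * ⟦ not (S r) ⟧ + ⟦ κ (tgt i) == r ⟧ * ⟦ not (S r) ⟧)
                  ≡⟨ ∑-distrib-+ (λ r → ⟦ κ (src i) == r ⟧ * ⟦ not (S r) ⟧) (λ r → ⟦ κ (tgt i) == r ⟧ * ⟦ not (S r) ⟧) ⟩
                sum (λ r → ⟦ κ (src i) == r ⟧ * ⟦ not (S r) ⟧) + sum (λ r → ⟦ κ (tgt i) == r ⟧ * ⟦ not (S r) ⟧)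
                  ≡⟨ cong₂ _+_ (trans (sum-delta (κ (src i)) (λ r → ⟦ not (S r) ⟧))
                      (cong (λ b → ⟦ not b ⟧) (S-κ (src i))))
                               (trans (sum-delta (κ (tgt i)) (λ r → ⟦ not (S r) ⟧))
                                   (cong (λ b → ⟦ not b ⟧) (S-κ (tgt i)))) ⟩
                ⟦ not (S (src i)) ⟧ + ⟦ not (S (tgt i)) ⟧ ≡⟨ *-identityˡ _ ⟨
                1 * (⟦ not (S (src i)) ⟧ + ⟦ not (S (tgt i)) ⟧) ∎

-- Rounding and the final estimates

floor-lower : ∀ q → floor q ℤ.* ↧ q ℤ.≤ ↥ q
floor-lower q@record{} = ℤ.[n/d]*d≤n (↥ q) (↧ q)

floor-upper : ∀ q → ↥ q ℤ.< ℤ.suc (floor q) ℤ.* ↧ q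
floor-upper q@record{} = subst (λ x → ↥ q ℤ.< ℤ.suc x ℤ.* ↧ q) (sym (ℤ.div-pos-is-/ℕ (↥ q) _)) (ℤ.n<s[n/ℕd]*d (↥ q) _)

ceiling-upper : ∀ q → ↥ q ℤ.≤ ceiling q ℤ.* ↧ q
ceiling-upper q@record{} = subst₂ ℤ._≤_ (trans (cong ℤ.-_ (ℚ.↥-neg q)) (ℤ.neg-involutive (↥ q)))
  (trans (ℤ.neg-distribˡ-* (floor (ℚ.- q)) (↧ (ℚ.- q))) (cong (ceiling q ℤ.*_) (ℚ.↧-neg q)))
  (ℤ.neg-mono-≤ (floor-lower (ℚ.- q)))

module _ (z : ℤ) (k : ℕ) .{{_ : NonZero k}} where

  private
    q = z ℚ./ k
    g = ℤ.gcd z (+ k)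

    denominator : ∀ x → x ℤ.* ↧ q ℤ.* g ≡ x ℤ.* + k
    denominator x = trans (ℤ.*-assoc x (↧ q) g) (cong (x ℤ.*_) (ℚ.↧-/ z k))

    positive : ∀ g k .{{_ : NonZero k}} → ↧ q ℤ.* + g ≡ + k → ℤ.Positive (+ g)
    positive zero (suc k) eq with () ← trans (sym (ℤ.*-zeroʳ (↧ q))) eq
    positive (suc g) k eq = _

  -- The fraction is stored in lowest terms, so the estimate for it is multiplied by the gcd;
  -- likewise in the next two lemmas.
  floor-/-lower : floor q ℤ.* + k ℤ.≤ z
  floor-/-lower = subst₂ ℤ._≤_ (denominator (floor q)) (ℚ.↥-/ z k) (ℤ.*-monoʳ-≤-nonNeg g (floor-lower q))

  floor-/-upper : z ℤ.< ℤ.suc (floor q) ℤ.* + k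
  floor-/-upper = subst₂ ℤ._<_ (ℚ.↥-/ z k) (denominator (ℤ.suc (floor q)))
    (ℤ.*-monoʳ-<-pos g {{positive _ k (ℚ.↧-/ z k)}} (floor-upper q))

  ceiling-/-upper : z ℤ.≤ ceiling q ℤ.* + k
  ceiling-/-upper = subst₂ ℤ._≤_ (ℚ.↥-/ z k) (denominator (ceiling q)) (ℤ.*-monoʳ-≤-nonNeg g (ceiling-upper q))

-- A negative `β` could not dominate a natural number, so from here on the bounds can be treated in
-- `ℕ`.
natural-≤ : ∀ x k β → + x ℤ.≤ β ℤ.* + k → .{{NonZero k}} → Σ ℕ λ b → β ≡ + b × x ≤ k * b
natural-≤ x k (+ b) le = b , refl , subst (x ≤_) (*-comm b k) (ℤ.drop‿+≤+ (subst (+ x ℤ.≤_) (sym (ℤ.pos-* b k)) le))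
natural-≤ x (suc k) -[1+ b ] ()

natural-< : ∀ x k β → + x ℤ.< β ℤ.* + k → .{{NonZero k}} → Σ ℕ λ b → β ≡ + b × x < k * b
natural-< x k (+ b) lt = b , refl , subst (x <_) (*-comm b k) (ℤ.drop‿+<+ (subst (+ x ℤ.<_) (sym (ℤ.pos-* b k)) lt))
natural-< x (suc k) -[1+ b ] ()

-- k times the bound of the theorem is at least m d + surplus.
surplus : Case → ℕ → ℕ → ℕ
surplus case1 m k = 2 * (m * (k ∸ m))
surplus case2 m k = m * (k ∸ m)
surplus case3 m k = m * k
surplus case4 m k = 0

-- The surplus comes from expanding, as in m(d - 2m) + 2mk = md + 2m(k - m). This is done in the
-- integers, since d may be smaller than 2m.
caseBound-natural : ∀ c m k d .{{_ : NonZero k}} → m ≤ k →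
                    Σ ℕ λ b → CaseBound c m k d ≡ + b × m * d + surplus c m k ≤ k * b
caseBound-natural c m k d m≤k = natural-≤ _ k (CaseBound c m k d) (lower c)
  where
  i = k ∸ m
  k≡ : + k ≡ + m ℤ.+ + i
  k≡ = trans (cong +_ (sym (m+[n∸m]≡n m≤k))) (ℤ.pos-+ m i)
  shifted : ∀ z s x → z ℤ.+ s ℤ.* + k ≡ x → x ℤ.≤ (ceiling (z ℚ./ k) ℤ.+ s) ℤ.* + k
  shifted z s x eq = subst₂ ℤ._≤_ eq (sym (ℤ.*-distribʳ-+ (+ k) (ceiling (z ℚ./ k)) s))
    (ℤ.+-monoˡ-≤ (s ℤ.* + k) (ceiling-/-upper z k))
  lower : ∀ c → + (m * d + surplus c m k) ℤ.≤ CaseBound c m k d ℤ.* + k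
  lower case1 = shifted (+ m ℤ.* (+ d ℤ.- + (2 * m))) (+ (2 * m)) _ (begin
      + m ℤ.* (+ d ℤ.- + (2 * m)) ℤ.+ + (2 * m) ℤ.* + k ≡⟨ cong₂ (λ x y → + m ℤ.* (+ d ℤ.- x) ℤ.+ x ℤ.* y)
          (ℤ.pos-* 2 m) k≡ ⟩
      + m ℤ.* (+ d ℤ.- + 2 ℤ.* + m) ℤ.+ + 2 ℤ.* + m ℤ.* (+ m ℤ.+ + i) ≡⟨ ring (+ m) (+ d) (+ i) ⟩
      + m ℤ.* + d ℤ.+ + 2 ℤ.* (+ m ℤ.* + i) ≡⟨ cong₂ (λ x y → x ℤ.+ + 2 ℤ.* y) (ℤ.pos-* m d) (ℤ.pos-* m i) ⟨
      + (m * d) ℤ.+ + 2 ℤ.* + (m * i) ≡⟨ cong (λ y → + (m * d) ℤ.+ y) (ℤ.pos-* 2 (m * i)) ⟨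
      + (m * d + 2 * (m * i)) ∎)
    where
    open ≡-Reasoning
    ring : ∀ m d i → m ℤ.* (d ℤ.- + 2 ℤ.* m) ℤ.+ + 2 ℤ.* m ℤ.* (m ℤ.+ i) ≡ m ℤ.* d ℤ.+ + 2 ℤ.* (m ℤ.* i)
    ring = ℤ.solve-∀
  lower case2 = shifted (+ m ℤ.* (+ d ℤ.- + m)) (+ m) _ (begin
      + m ℤ.* (+ d ℤ.- + m) ℤ.+ + m ℤ.* + k ≡⟨ cong (λ y → + m ℤ.* (+ d ℤ.- + m) ℤ.+ + m ℤ.* y) k≡ ⟩
      + m ℤ.* (+ d ℤ.- + m) ℤ.+ + m ℤ.* (+ m ℤ.+ + i) ≡⟨ ring (+ m) (+ d) (+ i) ⟩
      + m ℤ.* + d ℤ.+ + m ℤ.* + i ≡⟨ cong₂ ℤ._+_ (ℤ.pos-* m d) (ℤ.pos-* m i) ⟨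
      + (m * d + m * i) ∎)
    where
    open ≡-Reasoning
    ring : ∀ m d i → m ℤ.* (d ℤ.- m) ℤ.+ m ℤ.* (m ℤ.+ i) ≡ m ℤ.* d ℤ.+ m ℤ.* i
    ring = ℤ.solve-∀
  lower case3 = shifted (+ (m * d)) (+ m) _ (cong (λ y → + (m * d) ℤ.+ y) (sym (ℤ.pos-* m k)))
  lower case4 = subst (λ x → + x ℤ.≤ CaseBound case4 m k d ℤ.* + k) (sym (+-identityʳ (m * d)))
      (ceiling-/-upper (+ (m * d)) k)

floorBound-natural : ∀ m k d .{{_ : NonZero k}} → Σ ℕ λ b → FloorBound m k d ≡ + b × k * b ≤ m * d × m * d < k * b + k
floorBound-natural m k d with natural-< (m * d) k (ℤ.suc (FloorBound m k d)) (floor-/-upper (+ (m * d)) k)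
... | zero , eq , lt = ⊥-elim (n≮0 (subst (m * d <_) (*-zeroʳ k) lt))
... | suc b , eq , lt = b , F≡b , ℤ.drop‿+≤+ (subst (ℤ._≤ + (m * d))
    (trans (cong (ℤ._* + k) F≡b) (trans (sym (ℤ.pos-* b k)) (cong +_ (*-comm b k)))) (floor-/-lower (+ (m * d)) k)) ,
    subst (m * d <_) (trans (*-suc k b) (+-comm k (k * b))) lt
  where
  F≡b : FloorBound m k d ≡ + b
  F≡b = trans (sym (ℤ.pred-suc (FloorBound m k d))) (cong ℤ.pred eq)

-- The amount by which `L` exceeds `R` is supplied explicitly, so that a ring identity finishes each
-- contradiction.
absurd : ∀ {L R} x → L ≤ R → L ≡ suc (R + x) → ⊥
absurd {L} {R} x le eq = <⇒≱ (≤-trans (s≤s (m≤m+n R x)) (≤-reflexive (sym eq))) le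

infixr 5 _⊹_
_⊹_ : ∀ {a b c d} → a ≤ b → c ≤ d → a + c ≤ b + d
_⊹_ = +-mono-≤

infixr 6 _⊛_
_⊛_ : ∀ {a b} k → a ≤ b → k * a ≤ k * b
k ⊛ h = *-monoʳ-≤ k h

-- Each contradiction is a nonnegative combination of the hypotheses whose coefficients cancel all variables but a
-- surplus; k is written as m + j or m + (m + j) to avoid subtraction.
module Contradictions (m j : ℕ) {p a aG c D s hS : ℕ} (cert : hS + c + m + 1 ≤ m * p + a) where

  refute-edge : let k = m + (m + j); δ = 2 * (m * (m + j)) in a ≤ aG → a + m ≤ m * s →
                   k * p + 2 * aG ≤ D + 2 * c + k * s → suc (m * D + δ * s) ≤ k * hS + (k + δ) → ⊥
  -- The factor k of `cert` matches `load`, and the factor m of `edge` then cancels p. The term k a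
  -- is split into 2m a, paid by `aG`, and j a, paid by the sparsity of S; the remainder is j c.
  refute-edge a≤ a+m≤ edge load = absurd (j * c) ((m + (m + j)) ⊛ cert ⊹ load ⊹ m ⊛ edge ⊹ j ⊛ a+m≤ ⊹ (2 * m) ⊛ a≤)
    (ring m j p a aG c D s hS)
    where
    ring : ∀ m j p a aG c D s hS →
      (m + (m + j)) * (hS + c + m + 1) + (suc (m * D + 2 * (m * (m + j)) * s) +
          (m * ((m + (m + j)) * p + 2 * aG) + (j * (a + m) + 2 * m * a)))
      ≡ suc (((m + (m + j)) * (m * p + a) + ((m + (m + j)) * hS + ((m + (m + j)) + 2 * (m * (m + j))) +
          (m * (D + 2 * c + (m + (m + j)) * s) + (j * (m * s) + 2 * m * aG)))) + j * c)
    ring = solve-∀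

  refute-tree : let k = m + j; δ = m * j in a ≤ aG → a + m ≤ m * s →
                   k * p + aG ≤ D + c + k → suc (m * D + δ * s) ≤ k * hS + (k + δ) → ⊥
  refute-tree a≤ a+m≤ tree load = absurd (j * c) ((m + j) ⊛ cert ⊹ load ⊹ m ⊛ tree ⊹ j ⊛ a+m≤ ⊹ m ⊛ a≤)
    (ring m j p a aG c D s hS)
    where
    ring : ∀ m j p a aG c D s hS →
      (m + j) * (hS + c + m + 1) + (suc (m * D + m * j * s) + (m * ((m + j) * p + aG) + (j * (a + m) + m * a)))
      ≡ suc (((m + j) * (m * p + a) + ((m + j) * hS + ((m + j) + m * j) +
          (m * (D + c + (m + j)) + (j * (m * s) + m * aG)))) + j * c)
    ring = solve-∀

  refute-edge-independent : let k = m + (m + j); δ = m * k in a ≤ 0 →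
                   k * p + 2 * aG ≤ D + 2 * c + k * s → suc (m * D + δ * s) ≤ k * hS + (k + δ) → ⊥
  refute-edge-independent a≤ edge load = absurd (j * c + 2 * m * aG)
      ((m + (m + j)) ⊛ cert ⊹ load ⊹ m ⊛ edge ⊹ (m + (m + j)) ⊛ a≤)
    (ring m j p a aG c D s hS)
    where
    ring : ∀ m j p a aG c D s hS →
      (m + (m + j)) * (hS + c + m + 1) + (suc (m * D + m * (m + (m + j)) * s) +
          (m * ((m + (m + j)) * p + 2 * aG) + (m + (m + j)) * a))
      ≡ suc (((m + (m + j)) * (m * p + a) + ((m + (m + j)) * hS + ((m + (m + j)) + m * (m + (m + j))) +
          (m * (D + 2 * c + (m + (m + j)) * s) + (m + (m + j)) * 0))) + (j * c + 2 * m * aG))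
    ring = solve-∀

  refute-tree-independent : let k = m + j in a ≤ 0 → k * p + aG ≤ D + c + k → suc (m * D + 0 * s) ≤ k * hS + (k + 0) → ⊥
  refute-tree-independent a≤ tree load = absurd (j * c + m * aG) ((m + j) ⊛ cert ⊹ load ⊹ m ⊛ tree ⊹ (m + j) ⊛ a≤)
    (ring m j p a aG c D s hS)
    where
    ring : ∀ m j p a aG c D s hS →
      (m + j) * (hS + c + m + 1) + (suc (m * D + 0 * s) + (m * ((m + j) * p + aG) + (m + j) * a))
      ≡ suc (((m + j) * (m * p + a) + ((m + j) * hS + ((m + j) + 0) + (m * (D + c + (m + j)) + (m + j) * 0))) +
          (j * c + m * aG))
    ring = solve-∀

  -- Without `S` every crossing edge is free and borders two parts, hence the factor 2 of `cert`.
  refute-edge-∅ : let k = m + (m + j) in a ≤ 0 → D ≤ 0 → s ≤ 0 → k * p + 2 * aG ≤ D + 2 * c + k * s → ⊥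
  refute-edge-∅ a≤ D≤ s≤ edge = absurd (2 * hS + 2 * m + 1 + j * p + 2 * aG)
    (2 ⊛ cert ⊹ edge ⊹ 2 ⊛ a≤ ⊹ D≤ ⊹ (m + (m + j)) ⊛ s≤) (ring m j p a aG c D s hS)
    where
    ring : ∀ m j p a aG c D s hS →
      2 * (hS + c + m + 1) + ((m + (m + j)) * p + 2 * aG + (2 * a + (D + (m + (m + j)) * s)))
      ≡ suc ((2 * (m * p + a) + (D + 2 * c + (m + (m + j)) * s + (2 * 0 + (0 + (m + (m + j)) * 0)))) +
          (2 * hS + 2 * m + 1 + j * p + 2 * aG))
    ring = solve-∀

  refute-tree-∅ : let k = m + j in a ≤ 0 → D ≤ 0 → 1 ≤ p → k * p + aG ≤ D + c + k → ⊥
  refute-tree-∅ a≤ D≤ 1≤p tree = absurd (hS + aG) (cert ⊹ tree ⊹ a≤ ⊹ D≤ ⊹ j ⊛ 1≤p) (ring m j p a aG c D hS)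
    where
    ring : ∀ m j p a aG c D hS →
      hS + c + m + 1 + ((m + j) * p + aG + (a + (D + j * 1)))
      ≡ suc ((m * p + a + (D + c + (m + j) + (0 + (0 + j * p)))) + (hS + aG))
    ring = solve-∀

module _ (m k δ : ℕ) .{{_ : NonZero k}} {d h : ℕ} where

  selected-< : ∀ s → (s ≡ true → m * d < k * h + k) → m * (⟦ s ⟧ * d) + δ * ⟦ s ⟧ < k * (⟦ s ⟧ * h) + 1 * (k + δ)
  selected-< true lt = subst₂ _<_ (r1 m d δ) (r2 k h δ) (+-monoˡ-< δ (lt refl))
    where
    r1 : ∀ m d δ → m * d + δ ≡ m * (1 * d) + δ * 1
    r1 = solve-∀
    r2 : ∀ k h δ → k * h + k + δ ≡ k * (1 * h) + 1 * (k + δ)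
    r2 = solve-∀
  selected-< false _ = subst₂ _<_ (r1 m δ) (r2 k δ) (≤-trans (>-nonZero⁻¹ k) (m≤m+n k δ))
    where
    r1 : ∀ m δ → 0 ≡ m * 0 + δ * 0
    r1 = solve-∀
    r2 : ∀ k δ → k + δ ≡ k * 0 + 1 * (k + δ)
    r2 = solve-∀

  selected-≤ : ∀ s → (s ≡ true → m * d + δ ≤ k * h) → m * (⟦ s ⟧ * d) + δ * ⟦ s ⟧ ≤ k * (⟦ s ⟧ * h)
  selected-≤ true le = subst₂ _≤_ (r1 m d δ) (cong (k *_) (sym (*-identityˡ h))) (le refl)
    where
    r1 : ∀ m d δ → m * d + δ ≡ m * (1 * d) + δ * 1
    r1 = solve-∀
  selected-≤ false _ = ≤-trans (≤-reflexive (r1 m δ)) z≤n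
    where
    r1 : ∀ m δ → m * 0 + δ * 0 ≡ 0
    r1 = solve-∀

pick : Bool → Bool → ℕ → ℕ → ℕ → ℕ
pick true true x y z = x
pick true false x y z = y
pick false _ x y z = z

-- Refutation of unfinished stages and assembly of the theorem

module _ (G : Graph) where

  open Sparsity G
  open Connectivity G
  open Counting G

  degree-≤ : ∀ H v → degree H v ≤ e G
  degree-≤ H v = subst (degree H v ≤_) (size-full (e G)) (size-mono {A = H ∩ at v} {λ _ → true} λ _ _ → refl)

  deg-⊤ : ∀ v → deg G ⊤ v ≡ degree all v
  deg-⊤ v = trans (deg-degree ⊤ v) (degree-local v λ i _ → lookup-replicate i true)

  module Theorem (m k : ℕ) .{{_ : NonZero m}} .{{_ : NonZero k}} (X : Subset (n G)) (c : Case) (hyp : CaseHyp c G X m k)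
                 (M : Factor G) (degM : MaxDegLe G M m) (u : Fin (n G)) where

    m≤k : m ≤ k
    m≤k = go c hyp
      where
      2m≤k : 2 * m ≤ k → m ≤ k
      2m≤k = ≤-trans (m≤m+n m _)
      go : ∀ c → CaseHyp c G X m k → m ≤ k
      go case1 (_ , le) = 2m≤k le
      go case2 (_ , le) = le
      go case3 (_ , le , _) = 2m≤k le
      go case4 (_ , le , _) = le

    δ : ℕ
    δ = surplus c m k

    degM' : ∀ v → degree (lookup M) v ≤ m
    degM' v = subst (_≤ m) (deg-degree M v) (degM v)

    module Refutation (h : Fin (n G) → ℕ) (h-off : ∀ v → lookup X v ≡ false → e G < h v)
                      (h-X : ∀ v → lookup X v ≡ true → u ≢ v → m * deg G ⊤ v + δ ≤ k * h v)
                      (h-u : lookup X u ≡ true → m * deg G ⊤ u < k * h u + k) where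

      open Descent G m (lookup M) h degM'

      module _ {H : ESet} (adm : Admissible H) (st : Stage H) (closed : Closed H st) (defect : 1 ≤ potential H) where

        open Stage st
        module C = Certificate {m} {lookup M} {h} degM'
        D hS p a aG : ℕ
        D = C.D adm st closed defect u
        hS = C.hS adm st closed defect u
        p = C.p adm st closed defect u
        a = C.a adm st closed defect u
        aG = C.aG adm st closed defect u

        S⊑X : S ⊑ lookup X
        S⊑X v s with true-or-false (lookup X v)
        ... | inj₁ q = q
        ... | inj₂ q = ⊥-elim (<⇒≱ (s≤s (degree-≤ H v)) (≤-trans (h-off v q) (loaded v s)))

        -- The allowance k + δ covers `u`, which lacks its surplus δ and loses less than k by
        -- rounding down. The inequality is strict at `u` whether or not `u` lies in `S`.
        load : suc (m * D + δ * size S) ≤ k * hS + (k + δ)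
        load = begin-strict
            m * D + δ * size S ≡⟨ cong₂ _+_ (*-distribˡ-sum m (λ v → ⟦ S v ⟧ * degree all v))
                (*-distribˡ-sum δ (λ v → ⟦ S v ⟧)) ⟩
            sum (λ v → m * (⟦ S v ⟧ * degree all v)) + sum (λ v → δ * ⟦ S v ⟧) ≡⟨ ∑-distrib-+
                (λ v → m * (⟦ S v ⟧ * degree all v)) (λ v → δ * ⟦ S v ⟧) ⟨
            sum (λ v → m * (⟦ S v ⟧ * degree all v) + δ * ⟦ S v ⟧) <⟨ sum-mono-< {n G} vertex u at-u ⟩
            sum (λ v → k * (⟦ S v ⟧ * h v) + ⟦ u == v ⟧ * (k + δ)) ≡⟨ ∑-distrib-+ (λ v → k * (⟦ S v ⟧ * h v))
                (λ v → ⟦ u == v ⟧ * (k + δ)) ⟩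
            sum (λ v → k * (⟦ S v ⟧ * h v)) + sum (λ v → ⟦ u == v ⟧ * (k + δ)) ≡⟨ cong₂ _+_
                (*-distribˡ-sum k (λ v → ⟦ S v ⟧ * h v)) (sym (sum-delta u (λ _ → k + δ))) ⟨
            k * hS + (k + δ) ∎
          where
          open ≤-Reasoning
          at-u : m * (⟦ S u ⟧ * degree all u) + δ * ⟦ S u ⟧ < k * (⟦ S u ⟧ * h u) + ⟦ u == u ⟧ * (k + δ)
          at-u = subst (λ b → m * (⟦ S u ⟧ * degree all u) + δ * ⟦ S u ⟧ < k * (⟦ S u ⟧ * h u) + ⟦ b ⟧ * (k + δ))
              (sym (==-refl u))
            (selected-< m k δ (S u) λ s → subst (λ d → m * d < k * h u + k) (deg-⊤ u) (h-u (S⊑X u s)))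
          vertex : ∀ v → m * (⟦ S v ⟧ * degree all v) + δ * ⟦ S v ⟧ ≤ k * (⟦ S v ⟧ * h v) + ⟦ u == v ⟧ * (k + δ)
          vertex v = by-cases (u ≟ v)
            where
            by-cases : Dec (u ≡ v) → m * (⟦ S v ⟧ * degree all v) + δ * ⟦ S v ⟧ ≤ k * (⟦ S v ⟧ * h v) + ⟦ u == v ⟧ *
                (k + δ)
            by-cases (yes refl) = <⇒≤ at-u
            by-cases (no ne) = ≤-trans (selected-≤ m k δ (S v) λ s → subst (λ d → m * d + δ ≤ k * h v) (deg-⊤ v)
                (h-X v (S⊑X v s) ne)) (m≤m+n _ _)

        c' : ℕ
        c' = C.c adm st closed defect u

        cert : hS + c' + m + 1 ≤ m * p + a
        cert = C.certificate adm st closed defect u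

        a≤aG : a ≤ aG
        a≤aG = C.a≤aG adm st closed defect u

        a+m≤ : ∀ v → S v ≡ true → a + m ≤ m * size S
        a+m≤ = bound (proj₁ adm) S

        independent : Independent G X → a ≤ 0
        independent ind = ≤-reflexive (sum-zero {f = λ i → ⟦ (H ∩ within S) i ⟧} λ i → cong ⟦_⟧ (not-true λ q →
          let w = proj₂ (∧-true {H i} q) in
          ind i (lookup⇒∈ (S⊑X _ (within-src S i w)) , lookup⇒∈ (S⊑X _ (within-tgt S i w)))))

        1≤p : 1 ≤ p
        1≤p = size-pos (fixed κ) (κ u) (==-complete (idem u))

        module Empty (none : ∀ v → S v ≡ false) where

          s≤0 : size S ≤ 0
          s≤0 = ≤-reflexive (sum-zero {f = λ v → ⟦ S v ⟧} λ v → cong ⟦_⟧ (none v))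

          D≤0 : D ≤ 0
          D≤0 = ≤-reflexive (sum-zero {f = λ v → ⟦ S v ⟧ * degree all v} λ v → cong (λ b → ⟦ b ⟧ * degree all v)
              (none v))

          a≤0 : a ≤ 0
          a≤0 = ≤-reflexive (sum-zero {f = λ i → ⟦ (H ∩ within S) i ⟧} λ i → cong ⟦_⟧ (not-true λ q →
            false≢true (trans (sym (none (src i))) (within-src S i (proj₂ (∧-true {H i} q))))))

          -- With a single part, `cert` would claim m + 1 ≤ m.
          2≤p : 2 ≤ p
          2≤p = ≮⇒≥ λ { (s≤s p≤1) → absurd (hS + c') (cert ⊹ m ⊛ p≤1 ⊹ a≤0) (r1 m hS c' p a) }
            where
            r1 : ∀ m hS c p a → hS + c + m + 1 + (m * p + a) ≡ suc ((m * p + a + (m * 1 + 0)) + (hS + c))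
            r1 = solve-∀

          other-∅ : ∀ r → fixed κ r ≡ true → S r ≡ false → Σ (Fin (n G)) λ b → κ b ≢ r
          other-∅ r _ _ with size-gap {A = fixed κ} {B = ⟨ r ⟩} (subst (_< p) (sym (size-⟨⟩ r)) 2≤p)
          ... | b , f , g = b , λ q → false≢true (trans (sym g) (==-complete (trans (sym q) (==-sound f))))

        -- A vertex of `S` lies outside every part that misses `S`.
        other : ∀ v → S v ≡ true → ∀ r → fixed κ r ≡ true → S r ≡ false → Σ (Fin (n G)) λ b → κ b ≢ r
        other v s r _ q = v , λ eq → false≢true (trans (sym q)
            (trans (cong S (sym eq)) (trans (C.S-κ adm st closed defect u v) s)))

        edge : EdgeConnected G k → (∀ r → fixed κ r ≡ true → S r ≡ false → Σ (Fin (n G)) λ b → κ b ≢ r) →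
               k * p + 2 * aG ≤ D + 2 * c' + k * size S
        edge = C.edge-count adm st closed defect u

        tree : GTreeConnected G k → k * p + aG ≤ D + c' + k
        tree = C.tree-count adm st closed defect u

        k-split : k ≡ m + (k ∸ m)
        k-split = sym (m+[n∸m]≡n m≤k)

        k-split-twice : 2 * m ≤ k → k ∸ m ≡ m + (k ∸ m ∸ m)
        k-split-twice le = sym (m+[n∸m]≡n (m+n≤o⇒m≤o∸n m
            (≤-trans (≤-reflexive (cong (λ x → m + x) (sym (+-identityʳ m)))) le)))

        module Arithmetic = Contradictions m

        refute : ⊥
        refute with any? (λ v → S v Bool.≟ true)
        ... | no none = empty c hyp
          where
          open Empty (λ v → not-true λ s → none (v , s))
          edge-case : EdgeConnected G k → 2 * m ≤ k → ⊥
          edge-case conn le = Arithmetic.refute-edge-∅ (k ∸ m ∸ m) {p} {a} {aG} {c'} {D} {size S} {hS} cert a≤0 D≤0 s≤0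
            (subst (λ k → k * p + 2 * aG ≤ D + 2 * c' + k * size S)
                (trans k-split (cong (λ x → m + x) (k-split-twice le)))
              (edge conn other-∅))
          tree-case : GTreeConnected G k → ⊥
          tree-case conn = Arithmetic.refute-tree-∅ (k ∸ m) {p} {a} {aG} {c'} {D} {size S} {hS} cert a≤0 D≤0 1≤p
            (subst (λ k → k * p + aG ≤ D + c' + k) k-split (tree conn))
          empty : ∀ c → CaseHyp c G X m k → ⊥
          empty case1 (conn , le) = edge-case conn le
          empty case2 (conn , le) = tree-case conn
          empty case3 (conn , le , _) = edge-case conn le
          empty case4 (conn , le , _) = tree-case conn
        ... | yes (v , s) = nonempty c hyp load
          where
          j = k ∸ m ∸ m
          Load : ℕ → ℕ → Set
          Load k δ = suc (m * D + δ * size S) ≤ k * hS + (k + δ)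
          nonempty : ∀ c → CaseHyp c G X m k → Load k (surplus c m k) → ⊥
          nonempty case1 (conn , le) ld = Arithmetic.refute-edge j {p} {a} {aG} {c'} {D} {size S} {hS} cert a≤aG
              (a+m≤ v s)
              (subst (λ k → k * p + 2 * aG ≤ D + 2 * c' + k * size S) k≡ (edge conn (other v s)))
              (subst₂ (λ k i → Load k (2 * (m * i))) k≡ (k-split-twice le) ld)
            where
            k≡ = trans k-split (cong (λ x → m + x) (k-split-twice le))
          nonempty case2 (conn , le) ld = Arithmetic.refute-tree
              (k ∸ m) {p} {a} {aG} {c'} {D} {size S} {hS} cert a≤aG (a+m≤ v s)
              (subst (λ k → k * p + aG ≤ D + c' + k) k-split (tree conn))
                  (subst (λ x → Load x (m * (k ∸ m))) k-split ld)
          nonempty case3 (conn , le , ind) ld = Arithmetic.refute-edge-independent j {p} {a} {aG} {c'} {D} {size S} {hS} cert (independent ind)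
              (subst (λ k → k * p + 2 * aG ≤ D + 2 * c' + k * size S) k≡ (edge conn (other v s)))
              (subst (λ k → Load k (m * k)) k≡ ld)
            where
            k≡ = trans k-split (cong (λ x → m + x) (k-split-twice le))
          nonempty case4 (conn , le , ind) ld = Arithmetic.refute-tree-independent
              (k ∸ m) {p} {a} {aG} {c'} {D} {size S} {hS} cert (independent ind)
              (subst (λ k → k * p + aG ≤ D + c' + k) k-split (tree conn)) (subst (λ x → Load x 0) k-split ld)

    ceil-bound : ∀ v → Σ ℕ λ b → CaseBound c m k (deg G ⊤ v) ≡ + b × m * deg G ⊤ v + δ ≤ k * b
    ceil-bound v = caseBound-natural c m k (deg G ⊤ v) m≤k

    floor-bound : ∀ v → Σ ℕ λ b → FloorBound m k (deg G ⊤ v) ≡ + b × k * b ≤ m * deg G ⊤ v × m * deg G ⊤ v < k * b + k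
    floor-bound v = floorBound-natural m k (deg G ⊤ v)

    -- Outside X the bound exceeds every degree, so it is never attained.
    h : Fin (n G) → ℕ
    h v = pick (lookup X v) (u == v) (proj₁ (floor-bound v)) (proj₁ (ceil-bound v)) (suc (e G))

    h-u : lookup X u ≡ true → h u ≡ proj₁ (floor-bound u)
    h-u p = cong₂ (λ x y → pick x y (proj₁ (floor-bound u)) (proj₁ (ceil-bound u)) (suc (e G))) p (==-refl u)

    h-X : ∀ v → lookup X v ≡ true → u ≢ v → h v ≡ proj₁ (ceil-bound v)
    h-X v p ne = cong₂ (λ x y → pick x y (proj₁ (floor-bound v)) (proj₁ (ceil-bound v)) (suc (e G))) p (≢⇒== ne)

    h-off : ∀ v → lookup X v ≡ false → h v ≡ suc (e G)
    h-off v p = cong (λ x → pick x (u == v) (proj₁ (floor-bound v)) (proj₁ (ceil-bound v)) (suc (e G))) p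

    open Descent G m (lookup M) h degM' using (descent)
    open Refutation h (λ v q → ≤-reflexive (sym (h-off v q)))
      (λ v q ne → subst (λ x → m * deg G ⊤ v + δ ≤ k * x) (sym (h-X v q ne)) (proj₂ (proj₂ (ceil-bound v))))
      (λ q → subst (λ x → m * deg G ⊤ u < k * x + k) (sym (h-u q)) (proj₂ (proj₂ (proj₂ (floor-bound u))))) using
          (refute)

    Goal : Factor G → Set
    Goal H = GoodFactor G X m k c M H × (u ∈ X → + deg G H u ℤ.≤ FloorBound m k (deg G ⊤ u))

    goal? : ∀ H → Dec (Goal H)
    goal? H = ((M ⊆? H) ×-dec (treeConnected? m H ×-dec all? λ v → (v ∈? X) →-dec
        (+ deg G H v ℤ.≤? CaseBound c m k (deg G ⊤ v))))
              ×-dec ((u ∈? X) →-dec (+ deg G H u ℤ.≤? FloorBound m k (deg G ⊤ u)))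

    module _ (H : ESet) (M⊑H : lookup M ⊑ H) (fits : ∀ v → degree H v ≤ h v) where

      private
        T = tabulate H

      degT : ∀ v → deg G T v ≤ h v
      degT v = ≤-trans (≤-reflexive (trans (deg-degree T v) (degree-local v λ i _ → lookup∘tabulate H i))) (fits v)

      floor-ok : u ∈ X → + deg G T u ℤ.≤ FloorBound m k (deg G ⊤ u)
      floor-ok uX = subst (+ deg G T u ℤ.≤_) (sym (proj₁ (proj₂ (floor-bound u))))
          (ℤ.+≤+ (subst (deg G T u ≤_) (h-u (∈⇒lookup uX)) (degT u)))

      -- Needed because `h u` is the floor, while `u` must also meet the bound of its case.
      floor≤ceil : proj₁ (floor-bound u) ≤ proj₁ (ceil-bound u)
      floor≤ceil = *-cancelˡ-≤ k (≤-trans (proj₁ (proj₂ (proj₂ (floor-bound u))))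
          (≤-trans (m≤m+n _ δ) (proj₂ (proj₂ (ceil-bound u)))))

      ceil-ok : ∀ v → v ∈ X → + deg G T v ℤ.≤ CaseBound c m k (deg G ⊤ v)
      ceil-ok v vX = subst (+ deg G T v ℤ.≤_) (sym (proj₁ (proj₂ (ceil-bound v)))) (ℤ.+≤+ (go (u ≟ v)))
        where
        go : Dec (u ≡ v) → deg G T v ≤ proj₁ (ceil-bound v)
        go (no ne) = subst (deg G T v ≤_) (h-X v (∈⇒lookup vX) ne) (degT v)
        go (yes refl) = ≤-trans (subst (deg G T u ≤_) (h-u (∈⇒lookup vX)) (degT u)) floor≤ceil

      goal : TreeConnected G m T → Goal T
      goal tc = ((λ {i} iM → lookup⇒∈ (trans (lookup∘tabulate H i) (M⊑H i (∈⇒lookup iM)))) , tc , ceil-ok) , floor-ok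

    -- As `Goal` is decidable and factors are searchable, a contradiction from their absence
    -- suffices. `u` need not belong to `X`; it also serves as the witness that the vertex set is
    -- nonempty.
    solution : Σ (Factor G) Goal
    solution = decidable-stable (subset-searchable goal?) λ no-goal →
      descent (sparse-of-degree degM') (λ H → refute) λ { (H , (sp , M⊑H) , fits , total) →
        sparse⇒treeConnected (tabulate H) u (sparse-cong (λ i → sym (lookup∘tabulate H i)) sp)
          (subst (λ x → m * n G ≤ x + m) (sym (size-cong (lookup∘tabulate H))) total)
          λ tc → no-goal (tabulate H , goal H M⊑H fits tc) }

theorem5p2 : (m k : ℕ) → .{{_ : NonZero m}} → .{{_ : NonZero k}} →
    (G : Graph) (X : Subset (n G)) (c : Case) → CaseHyp c G X m k →
    (M : Factor G) → MaxDegLe G M m →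
    Σ (Factor G) (λ H → GoodFactor G X m k c M H)
    × (∀ u → u ∈ X → Σ (Factor G) (λ H → GoodFactor G X m k c M H
    × + deg G H u ℤ.≤ FloorBound m k (deg G ⊤ u)))
theorem5p2 m k G X c hyp M degM = first , λ u uX → case solution u of λ { (H , good , floor) → H , good , floor uX }
  where
  open Theorem G m k X c hyp M degM
  first : Σ (Factor G) (λ H → GoodFactor G X m k c M H)
  -- Any vertex can play `u` here. A graph without vertices has no edges, and then `M` serves as
  -- every tree.
  first with any? {n = n G} (λ _ → yes tt)
  ... | yes (u , _) = case solution u of λ { (H , good , _) → H , good }
  ... | no none = M , (λ p → p) , ((λ _ → M) , (λ _ p → p) ,
          (λ _ → (λ x → ⊥-elim (none (x , tt))) , λ i → ⊥-elim (none (proj₁ (ends G i) , tt))) ,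
          λ _ _ i → ⊥-elim (none (proj₁ (ends G i) , tt))) , λ v → ⊥-elim (none (v , tt))
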